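{- Let $T$ be a finite tree of order at least $3$. Then $T$ is $2$-critical with $\mathrm{sd}(T)=2$ if and only if $T$ is isomorphic to the path $P_{3k+2}$ for some integer $k\ge 1$.
   Context: All graphs are finite and simple; $P_n$ is the path on $n$ vertices. A set $D\subseteq V(G)$ is dominating if every vertex of $V(G)\setminus D$ has a neighbour in $D$; $\gamma(G)$ is the minimum cardinality of a dominating set of $G$. For $F\subseteq E(G)$, $G_F$ denotes the graph obtained from $G$ by subdividing each edge of $F$ exactly once (each edge $uv\in F$ is replaced by a path $u,w,v$ with a new vertex $w$). For an integer $q\ge 1$, a connected graph $G$ of order at least $3$ is called $q$-critical ($\gamma$-$q$-critical) if $\gamma(G_F)>\gamma(G)$ for every $F\subseteq E(G)$ with $|F|=q$, and there is a set $F'\subseteq E(G)$ with $|F'|=q-1$ such that $\gamma(G_{F'})=\gamma(G)$. The domination subdivision number $\mathrm{sd}(G)$ is the minimum cardinality of a set $F\subseteq E(G)$ such that $\gamma(G_F)>\gamma(G)$. -}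

module Defs where

open import Data.Fin using (Fin; zero; suc; toℕ; inject₁; fromℕ; splitAt) renaming (_<_ to _<ᶠ_)
import Data.Fin.Properties as Fin
open import Data.Fin.Subset using (Subset; _∈_; _∉_; ∣_∣; ⊤)
open import Data.Fin.Subset.Properties using (anySubset?; _∈?_; ∈⊤; ∣⊤∣≡n)
open import Data.Nat using (ℕ; zero; suc; _+_; _∸_; _≤_; _≥_; _>_; z≤n; s≤s)
import Data.Nat.Properties as ℕ
open import Data.Product using (∃; ∃-syntax; _×_; _,_; proj₁; proj₂)
open import Data.Product.Properties using (≡-dec)
open import Data.Sum using (_⊎_; inj₁; inj₂; swap)
open import Data.Empty using (⊥)
open import Function using (_∘_)
open import Function.Bundles using (_↔_; _⇔_; Inverse)
open import Function.Definitions using (Injective)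
open import Relation.Binary using (Rel; Decidable; Symmetric; Irreflexive)
open import Relation.Binary.Construct.Closure.ReflexiveTransitive using (Star)
open import Relation.Binary.PropositionalEquality using (_≡_; refl; cong)
open import Relation.Nullary using (yes; no; ¬_; ¬?; contradiction; _×-dec_; _⊎-dec_; _→-dec_)
import Relation.Unary as U
open import Level using (0ℓ)

-- Finite simple graphs; the vertex set of a graph of order n is Fin n.
record Graph (n : ℕ) : Set₁ where
  field
    Adj    : Rel (Fin n) 0ℓ
    adj?   : Decidable Adj
    adjSym : Symmetric Adj
    irrefl : Irreflexive _≡_ Adj

open Graph public

record _≅_ {m n : ℕ} (G : Graph m) (H : Graph n) : Set where
  field
    vertices : Fin m ↔ Fin n
    adjacent : ∀ u v → Adj G u v ⇔ Adj H (Inverse.to vertices u) (Inverse.to vertices v)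

Path : (n : ℕ) → Graph n
Path n = record
  { Adj    = λ i j → suc (toℕ i) ≡ toℕ j ⊎ suc (toℕ j) ≡ toℕ i
  ; adj?   = λ i j → (suc (toℕ i) ℕ.≟ toℕ j) ⊎-dec (suc (toℕ j) ℕ.≟ toℕ i)
  ; adjSym = swap
  ; irrefl = λ { refl (inj₁ e) → ℕ.1+n≢n e ; refl (inj₂ e) → ℕ.1+n≢n e }
  }

Connected : ∀ {n} → Graph n → Set
Connected G = ∀ u v → Star (Adj G) u v

record Cycle {n : ℕ} (G : Graph n) : Set where
  field
    {excess}  : ℕ
    vertex    : Fin (3 + excess) → Fin n
    distinct  : Injective _≡_ _≡_ vertex
    steps     : ∀ (i : Fin (2 + excess)) → Adj G (vertex (inject₁ i)) (vertex (suc i))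
    closing   : Adj G (vertex (fromℕ (2 + excess))) (vertex zero)

-- Nonemptiness is not required, so the graph of order 0 also qualifies.
IsTree : ∀ {n} → Graph n → Set
IsTree G = Connected G × ¬ Cycle G

IsLeast : (ℕ → Set) → ℕ → Set
IsLeast P k = P k × (∀ j → P j → k ≤ j)

least : {P : ℕ → Set} → U.Decidable P → ∀ m → P m → ∃ (IsLeast P)
least P? zero p = zero , p , λ _ _ → z≤n
least P? (suc m) p with P? zero
... | yes p₀ = zero , p₀ , λ _ _ → z≤n
... | no ¬p₀ with least (P? ∘ suc) m p
...   | k , pk , min = suc k , pk , λ
        { zero p₀ → contradiction p₀ ¬p₀
        ; (suc j) pj → s≤s (min j pj)
        }

Dominating : ∀ {n} → Graph n → Subset n → Set
Dominating G D = ∀ v → v ∉ D → ∃[ u ] (u ∈ D × Adj G v u)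

dominating? : ∀ {n} (G : Graph n) → U.Decidable (Dominating G)
dominating? G D =
  Fin.all? λ v → ¬? (v ∈? D) →-dec Fin.any? λ u → (u ∈? D) ×-dec adj? G v u

HasDominatingSet : ∀ {n} → Graph n → ℕ → Set
HasDominatingSet G k = ∃[ D ] (Dominating G D × ∣ D ∣ ≡ k)

γ-least : ∀ {n} (G : Graph n) → ∃ (IsLeast (HasDominatingSet G))
γ-least {n} G = least
  (λ k → anySubset? λ D → dominating? G D ×-dec (∣ D ∣ ℕ.≟ k))
  n (⊤ , (λ v v∉⊤ → contradiction ∈⊤ v∉⊤) , ∣⊤∣≡n n)

γ : ∀ {n} → Graph n → ℕ
γ G = proj₁ (γ-least G)

-- A set of exactly q edges, given by an injective enumeration.  An edge uv
-- is represented by its unique ordered pair with u < v, so that distinct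
-- pairs are distinct edges.
record EdgeSet {n : ℕ} (G : Graph n) (q : ℕ) : Set where
  field
    edge      : Fin q → Fin n × Fin n
    ordered   : ∀ k → proj₁ (edge k) <ᶠ proj₂ (edge k)
    isEdge    : ∀ k → Adj G (proj₁ (edge k)) (proj₂ (edge k))
    injective : Injective _≡_ _≡_ edge

  EndpointOf : Fin n → Fin q → Set
  EndpointOf v k = v ≡ proj₁ (edge k) ⊎ v ≡ proj₂ (edge k)

  Contains : Rel (Fin n) 0ℓ
  Contains u v = ∃[ k ] (edge k ≡ (u , v) ⊎ edge k ≡ (v , u))

  endpointOf? : Decidable EndpointOf
  endpointOf? v k = (v Fin.≟ proj₁ (edge k)) ⊎-dec (v Fin.≟ proj₂ (edge k))

  contains? : Decidable Contains
  contains? u v = Fin.any? λ k →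
    ≡-dec Fin._≟_ Fin._≟_ (edge k) (u , v) ⊎-dec ≡-dec Fin._≟_ Fin._≟_ (edge k) (v , u)

-- The vertices of the subdivided graph are those of G (inj₁) together with
-- one new vertex for each edge of F (inj₂).
module _ {n q : ℕ} (G : Graph n) (F : EdgeSet G q) where
  open EdgeSet F

  SubdividedAdj : Rel (Fin n ⊎ Fin q) 0ℓ
  SubdividedAdj (inj₁ u) (inj₁ v) = Adj G u v × ¬ Contains u v
  SubdividedAdj (inj₁ u) (inj₂ k) = EndpointOf u k
  SubdividedAdj (inj₂ k) (inj₁ v) = EndpointOf v k
  SubdividedAdj (inj₂ _) (inj₂ _) = ⊥

  subdividedAdj? : Decidable SubdividedAdj
  subdividedAdj? (inj₁ u) (inj₁ v) = adj? G u v ×-dec ¬? (contains? u v)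
  subdividedAdj? (inj₁ u) (inj₂ k) = endpointOf? u k
  subdividedAdj? (inj₂ k) (inj₁ v) = endpointOf? v k
  subdividedAdj? (inj₂ _) (inj₂ _) = no λ ()

  subdividedAdj-sym : Symmetric SubdividedAdj
  subdividedAdj-sym {inj₁ _} {inj₁ _} (a , ¬c) =
    adjSym G a , λ (k , e) → ¬c (k , swap e)
  subdividedAdj-sym {inj₁ _} {inj₂ _} e = e
  subdividedAdj-sym {inj₂ _} {inj₁ _} e = e

  subdividedAdj-irrefl : Irreflexive _≡_ SubdividedAdj
  subdividedAdj-irrefl {inj₁ _} refl (a , _) = irrefl G refl a
  subdividedAdj-irrefl {inj₂ _} refl ()

  subdivide : Graph (n + q)
  subdivide = record
    { Adj    = λ x y → SubdividedAdj (splitAt n x) (splitAt n y)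
    ; adj?   = λ x y → subdividedAdj? (splitAt n x) (splitAt n y)
    ; adjSym = λ {x} {y} → subdividedAdj-sym {splitAt n x} {splitAt n y}
    ; irrefl = λ {x} {y} e → subdividedAdj-irrefl {splitAt n x} {splitAt n y} (cong (splitAt n) e)
    }

record Critical (q : ℕ) {n : ℕ} (G : Graph n) : Set where
  field
    q≥1       : q ≥ 1
    order≥3   : n ≥ 3
    connected : Connected G
    increases : ∀ (F : EdgeSet G q) → γ (subdivide G F) > γ G
    preserved : ∃[ F′ ] (γ (subdivide {q = q ∸ 1} G F′) ≡ γ G)

-- sd(G) = k, as a relation because sd is partial: for instance no
-- subdivision of the path on two vertices increases γ.
SubdivisionNumber : ∀ {n} → Graph n → ℕ → Set
SubdivisionNumber G = IsLeast λ k → ∃[ F ] (γ (subdivide {q = k} G F) > γ G)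

-- Critical ⇒ path.  Fix a vertex v of T and cut T at v into branches, one for
-- each neighbour b.  A branch has three costs: the least number of its vertices
-- covering all of it except possibly b (ex), all of it (dom), or all of it
-- using b (inn); thus ex ≤ dom ≤ inn, and γ(T) is the smaller of 1 + Σ ex and
-- the least value of Σ dom with one dom replaced by inn.  Suppose v has three
-- neighbours.
--   * Two branches with ex < dom: subdividing the edge to one of them raises γ.
--   * Exactly one: an optimal set contains v, and two edges from v to other
--     branches can be subdivided for free.
--   * None, and every inn > dom: the same.
--   * None, and every inn = dom: three neighbours of v lie in one optimal set,
--     so two of the edges to them can be subdivided for free.
--   * None, with inn = dom for some branch and inn > dom for another:
--     subdividing the edge to the latter raises γ.
-- So T is a path.
--
-- A graph of maximum degree 2 on m vertices has γ ≥ m / 3, and every third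
-- vertex of a spanning walk dominates, so a path on m vertices has γ = ⌈m / 3⌉;
-- subdividing edges of a path yields a path, and residues modulo 3 decide.

module Submission where

open import Defs
open import Data.Nat using (ℕ; _+_; _*_; _≥_)
open import Data.Product using (∃-syntax; _×_)
open import Function.Bundles using (_⇔_)

open import Data.Empty using (⊥; ⊥-elim)
open import Data.Fin using (Fin; zero; suc; toℕ; fromℕ; inject₁; splitAt; join) renaming (_<_ to _<ᶠ_)
import Data.Fin.Properties as Fin
open import Data.Fin.Subset using (Subset; ∣_∣; ⁅_⁆; _∪_; inside; outside) renaming (_∈_ to _∈ˢ_; ⊥ to ∅)
open import Data.Fin.Subset.Properties using (_∈?_; ∣⊥∣≡0; ∣⁅x⁆∣≡1; x∈⁅x⁆; x∈p∪q⁺; anySubset?)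
open import Data.List using (List; []; _∷_; length; map; lookup; take; concatMap; applyUpTo; filter; allFin)
import Data.List.Properties as List
open import Data.List.Membership.DecPropositional using () renaming (_∈?_ to member?)
open import Data.List.Membership.Propositional using (_∈_; _∉_; find; lose)
open import Data.List.Membership.Propositional.Properties using (∈-map⁺; ∈-concatMap⁺; ∈-applyUpTo⁺; ∈-lookup; ∈-filter⁺; ∈-filter⁻; ∈-allFin)
open import Data.List.Relation.Unary.All using ([]; _∷_)
import Data.List.Relation.Unary.All as All
open import Data.List.Relation.Unary.Any using (here; there)
import Data.List.Relation.Unary.Any as Any
open import Data.List.Relation.Unary.Any.Properties using (lookup-index)
open import Data.List.Relation.Unary.Unique.Propositional using (Unique; []; _∷_)
import Data.List.Relation.Unary.Unique.Propositional.Properties as Unique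
open import Data.Nat using (zero; suc; pred; _≤_; _<_; _>_; z≤n; s≤s; _≤?_; _<?_)
open import Data.Nat.ListAction using (sum)
import Data.Nat.Properties as ℕ
open import Data.Product using (∃₂; _,_; proj₁; proj₂; map₂)
open import Data.Sum using (_⊎_; inj₁; inj₂; swap)
import Data.Sum as Sum
open import Data.Vec using ([]; _∷_; here; there)
open import Function using (_∘_)
open import Function.Bundles using (mk⇔; mk↔ₛ′; Inverse; Equivalence)
open import Function.Definitions using (Injective)
open import Level using (0ℓ)
open import Relation.Binary using (Rel; Symmetric; DecidableEquality; tri<; tri≈; tri>)
open import Relation.Binary.Construct.Closure.ReflexiveTransitive using (Star; ε; _◅_; _◅◅_; reverse)
open import Relation.Binary.PropositionalEquality using (_≡_; _≢_; refl; sym; trans; cong; subst; subst₂)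
open import Relation.Nullary using (¬_; Dec; yes; no; contradiction; ¬?; _×-dec_; _⊎-dec_; _→-dec_)
import Relation.Unary as U

-- Domination by lists of vertices.

-- Stated for any carrier, so that a subdivided graph can be handled on `Fin n ⊎ Fin q` directly.
-- Lists may repeat entries, which can only lengthen them.
Covers : {A : Set} → Rel A 0ℓ → List A → Set
Covers R xs = ∀ x → ∃[ u ] (u ∈ xs × (x ≡ u ⊎ R x u))

fromList : ∀ {n} → List (Fin n) → Subset n
fromList []       = ∅
fromList (x ∷ xs) = ⁅ x ⁆ ∪ fromList xs

∈-fromList : ∀ {n} {x : Fin n} {xs} → x ∈ xs → x ∈ˢ fromList xs
∈-fromList (here refl) = x∈p∪q⁺ (inj₁ (x∈⁅x⁆ _))
∈-fromList (there x∈)  = x∈p∪q⁺ (inj₂ (∈-fromList x∈))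

∣p∪q∣≤∣p∣+∣q∣ : ∀ {n} (p q : Subset n) → ∣ p ∪ q ∣ ≤ ∣ p ∣ + ∣ q ∣
∣p∪q∣≤∣p∣+∣q∣ []            []            = z≤n
∣p∪q∣≤∣p∣+∣q∣ (outside ∷ p) (outside ∷ q) = ∣p∪q∣≤∣p∣+∣q∣ p q
∣p∪q∣≤∣p∣+∣q∣ (outside ∷ p) (inside ∷ q)  =
  ℕ.≤-trans (s≤s (∣p∪q∣≤∣p∣+∣q∣ p q)) (ℕ.≤-reflexive (sym (ℕ.+-suc ∣ p ∣ ∣ q ∣)))
∣p∪q∣≤∣p∣+∣q∣ (inside ∷ p)  (outside ∷ q) = s≤s (∣p∪q∣≤∣p∣+∣q∣ p q)
∣p∪q∣≤∣p∣+∣q∣ (inside ∷ p)  (inside ∷ q)  =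
  s≤s (ℕ.≤-trans (∣p∪q∣≤∣p∣+∣q∣ p q) (ℕ.+-monoʳ-≤ ∣ p ∣ (ℕ.n≤1+n _)))

∣fromList∣≤length : ∀ {n} (xs : List (Fin n)) → ∣ fromList xs ∣ ≤ length xs
∣fromList∣≤length {n} []   = ℕ.≤-reflexive (∣⊥∣≡0 n)
∣fromList∣≤length (x ∷ xs) = ℕ.≤-trans (∣p∪q∣≤∣p∣+∣q∣ ⁅ x ⁆ (fromList xs))
  (ℕ.+-mono-≤ (ℕ.≤-reflexive (∣⁅x⁆∣≡1 x)) (∣fromList∣≤length xs))

elements : ∀ {n} → Subset n → List (Fin n)
elements []            = []
elements (inside ∷ p)  = zero ∷ map suc (elements p)
elements (outside ∷ p) = map suc (elements p)

∈-elements : ∀ {n} {x : Fin n} {p} → x ∈ˢ p → x ∈ elements p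
∈-elements here                        = here refl
∈-elements {p = inside ∷ _}  (there e) = there (∈-map⁺ suc (∈-elements e))
∈-elements {p = outside ∷ _} (there e) = ∈-map⁺ suc (∈-elements e)

length-elements : ∀ {n} (p : Subset n) → length (elements p) ≡ ∣ p ∣
length-elements []            = refl
length-elements (inside ∷ p)  = cong suc (trans (List.length-map suc (elements p)) (length-elements p))
length-elements (outside ∷ p) = trans (List.length-map suc (elements p)) (length-elements p)

γ≤length : ∀ {n} (G : Graph n) {xs} → Covers (Adj G) xs → γ G ≤ length xs
γ≤length G {xs} cov = ℕ.≤-trans
  (proj₂ (proj₂ (γ-least G)) _ (fromList xs , dom , refl)) (∣fromList∣≤length xs)
  where
  dom : Dominating G (fromList xs)
  dom v v∉ with cov v
  ... | u , u∈ , inj₁ refl = contradiction (∈-fromList u∈) v∉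
  ... | u , u∈ , inj₂ vu   = u , ∈-fromList u∈ , vu

γ-attained : ∀ {n} (G : Graph n) → ∃[ xs ] (Covers (Adj G) xs × length xs ≡ γ G)
γ-attained G with proj₁ (proj₂ (γ-least G))
... | D , dom , eq = elements D , cov , trans (length-elements D) eq
  where
  cov : Covers (Adj G) (elements D)
  cov v with v ∈? D
  ... | yes v∈ = v , ∈-elements v∈ , inj₁ refl
  ... | no v∉ with dom v v∉
  ...   | u , u∈ , vu = u , ∈-elements u∈ , inj₂ vu

module _ {n q} (G : Graph n) (F : EdgeSet G q) where

  subdivide-γ≤length : ∀ {ys} → Covers (SubdividedAdj G F) ys → γ (subdivide G F) ≤ length ys
  subdivide-γ≤length {ys} cov =
    ℕ.≤-trans (γ≤length (subdivide G F) cov′) (ℕ.≤-reflexive (List.length-map (join n q) ys))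
    where
    cov′ : Covers (Adj (subdivide G F)) (map (join n q) ys)
    cov′ x with cov (splitAt n x)
    ... | u , u∈ , inj₁ e  = join n q u , ∈-map⁺ (join n q) u∈ ,
                             inj₁ (trans (sym (Fin.join-splitAt n q x)) (cong (join n q) e))
    ... | u , u∈ , inj₂ xu = join n q u , ∈-map⁺ (join n q) u∈ ,
                             inj₂ (subst (SubdividedAdj G F (splitAt n x)) (sym (Fin.splitAt-join n q u)) xu)

  subdivide-γ-attained : ∃[ ys ] (Covers (SubdividedAdj G F) ys × length ys ≡ γ (subdivide G F))
  subdivide-γ-attained with γ-attained (subdivide G F)
  ... | xs , cov , eq = map (splitAt n) xs , cov′ , trans (List.length-map (splitAt n) xs) eq
    where
    cov′ : Covers (SubdividedAdj G F) (map (splitAt n) xs)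
    cov′ x with cov (join n q x)
    ... | u , u∈ , inj₁ e  = splitAt n u , ∈-map⁺ (splitAt n) u∈ ,
                             inj₁ (trans (sym (Fin.splitAt-join n q x)) (cong (splitAt n) e))
    ... | u , u∈ , inj₂ xu = splitAt n u , ∈-map⁺ (splitAt n) u∈ ,
                             inj₂ (subst (λ y → SubdividedAdj G F y (splitAt n u)) (Fin.splitAt-join n q x) xu)

  -- Old vertices alone dominate as long as no domination runs along a subdivided edge and each
  -- subdivided edge has a chosen end. This is how subdivisions are shown to be free.
  subdivide-γ≤ : ∀ {xs} → Covers (λ x u → Adj G x u × ¬ EdgeSet.Contains F x u) xs →
                 (∀ k → ∃[ u ] (u ∈ xs × EdgeSet.EndpointOf F u k)) → γ (subdivide G F) ≤ length xs
  subdivide-γ≤ {xs} cov touched =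
    ℕ.≤-trans (subdivide-γ≤length cov′) (ℕ.≤-reflexive (List.length-map inj₁ xs))
    where
    cov′ : Covers (SubdividedAdj G F) (map inj₁ xs)
    cov′ (inj₁ x) with cov x
    ... | u , u∈ , inj₁ refl = inj₁ u , ∈-map⁺ inj₁ u∈ , inj₁ refl
    ... | u , u∈ , inj₂ xu   = inj₁ u , ∈-map⁺ inj₁ u∈ , inj₂ xu
    cov′ (inj₂ k) with touched k
    ... | u , u∈ , e = inj₁ u , ∈-map⁺ inj₁ u∈ , inj₂ e

-- Rules out zero as a value of the domination subdivision number.
subdivide-∅ : ∀ {n} (G : Graph n) (F : EdgeSet G 0) → γ (subdivide G F) ≤ γ G
subdivide-∅ G F with γ-attained G
... | xs , cov , eq = ℕ.≤-trans (subdivide-γ≤ G F cov′ λ ()) (ℕ.≤-reflexive eq)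
  where
  cov′ : Covers (λ x u → Adj G x u × ¬ EdgeSet.Contains F x u) xs
  cov′ x with cov x
  ... | u , u∈ , inj₁ e  = u , u∈ , inj₁ e
  ... | u , u∈ , inj₂ xu = u , u∈ , inj₂ (xu , λ ())

-- Lower bounds on domination in maximum degree two.

∀∈⇒≤length : ∀ {n} (xs : List (Fin n)) → (∀ x → x ∈ xs) → n ≤ length xs
∀∈⇒≤length xs all = Fin.injective⇒≤ {f = λ x → Any.index (all x)} λ {x} {y} e →
  trans (lookup-index (all x)) (trans (cong (lookup xs) e) (sym (lookup-index (all y))))

-- The two candidates may coincide or fail to be neighbours of `x`, so the ends of a path are no
-- special case.
MaxDegree2 : {A : Set} → Rel A 0ℓ → Set
MaxDegree2 R = ∀ x → ∃₂ λ a b → ∀ y → R x y → y ≡ a ⊎ y ≡ b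

-- A chosen vertex dominates at most itself and its two candidates, so the concatenated triples
-- exhaust the graph.
order≤3*γ : ∀ {n} (G : Graph n) → MaxDegree2 (Adj G) → n ≤ 3 * γ G
order≤3*γ G deg with γ-attained G
... | xs , cov , eq = ℕ.≤-trans (∀∈⇒≤length _ all)
    (ℕ.≤-reflexive (trans (length-closed xs) (trans (ℕ.*-comm (length xs) 3) (cong (3 *_) eq))))
  where
  closed : Fin _ → List (Fin _)
  closed u = u ∷ proj₁ (deg u) ∷ proj₁ (proj₂ (deg u)) ∷ []
  length-closed : ∀ ys → length (concatMap closed ys) ≡ length ys * 3
  length-closed []       = refl
  length-closed (y ∷ ys) = cong (3 +_) (length-closed ys)
  all : ∀ x → x ∈ concatMap closed xs
  all x with cov x
  ... | u , u∈ , inj₁ refl = ∈-concatMap⁺ closed (Any.map (λ { refl → here refl }) u∈)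
  ... | u , u∈ , inj₂ xu with proj₂ (proj₂ (deg u)) x (adjSym G xu)
  ...   | inj₁ e = ∈-concatMap⁺ closed (Any.map (λ { refl → there (here e) }) u∈)
  ...   | inj₂ e = ∈-concatMap⁺ closed (Any.map (λ { refl → there (there (here e)) }) u∈)

module _ {n q} (G : Graph n) (F : EdgeSet G q) where
  open EdgeSet F

  -- Opposite orientations are impossible: `ordered` would give both `u < v` and `v < u`.
  sameEdge : ∀ {u v k l} → edge k ≡ (u , v) ⊎ edge k ≡ (v , u) →
             edge l ≡ (u , v) ⊎ edge l ≡ (v , u) → k ≡ l
  sameEdge (inj₁ e) (inj₁ f) = injective (trans e (sym f))
  sameEdge (inj₂ e) (inj₂ f) = injective (trans e (sym f))
  sameEdge {k = k} {l} (inj₁ e) (inj₂ f) with edge k | edge l | ordered k | ordered l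
  sameEdge (inj₁ refl) (inj₂ refl) | _ | _ | p | q = contradiction p (ℕ.<-asym q)
  sameEdge {k = k} {l} (inj₂ e) (inj₁ f) with edge k | edge l | ordered k | ordered l
  sameEdge (inj₂ refl) (inj₁ refl) | _ | _ | p | q = contradiction p (ℕ.<-asym q)

  endpoint-contains : ∀ {u k} → EndpointOf u k →
    ∃[ v ] (Adj G u v × (edge k ≡ (u , v) ⊎ edge k ≡ (v , u)))
  endpoint-contains {k = k} (inj₁ refl) = _ , isEdge k , inj₁ refl
  endpoint-contains {k = k} (inj₂ refl) = _ , adjSym G (isEdge k) , inj₂ refl

  contains-endpoint : ∀ {u v} → Contains u v → ∃[ k ] (EndpointOf u k × EndpointOf v k)
  contains-endpoint (k , inj₁ e) = k , inj₁ (sym (cong proj₁ e)) , inj₂ (sym (cong proj₂ e))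
  contains-endpoint (k , inj₂ e) = k , inj₂ (sym (cong proj₂ e)) , inj₁ (sym (cong proj₁ e))

  -- The neighbour met when leaving `u` along the edge to `v`, once `F` has been subdivided.
  towards : Fin n → Fin n → Fin n ⊎ Fin q
  towards u v with contains? u v
  ... | yes (k , _) = inj₂ k
  ... | no _        = inj₁ v

  towards-old : ∀ {u v} → ¬ Contains u v → towards u v ≡ inj₁ v
  towards-old {u} {v} ¬c with contains? u v
  ... | yes c = contradiction c ¬c
  ... | no _  = refl

  towards-new : ∀ {u v k} → edge k ≡ (u , v) ⊎ edge k ≡ (v , u) → towards u v ≡ inj₂ k
  towards-new {u} {v} {k} e with contains? u v
  ... | yes (l , f) = cong inj₂ (sameEdge f e)
  ... | no ¬c       = contradiction (k , e) ¬c

  -- A new vertex has just the two ends of its edge as neighbours. At an old vertex, subdivision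
  -- exchanges neighbours one for one through `towards`.
  subdivide-maxDegree2 : MaxDegree2 (Adj G) → MaxDegree2 (SubdividedAdj G F)
  subdivide-maxDegree2 deg (inj₂ k) =
    inj₁ (proj₁ (edge k)) , inj₁ (proj₂ (edge k)) , λ where
      (inj₁ y) (inj₁ e) → inj₁ (cong inj₁ e)
      (inj₁ y) (inj₂ e) → inj₂ (cong inj₁ e)
  subdivide-maxDegree2 deg (inj₁ u) with deg u
  ... | a , b , only = towards u a , towards u b , λ where
      (inj₁ y) (uy , ¬c) → case₁ (only y uy) ¬c
      (inj₂ k) e → let v , uv , eq = endpoint-contains e in case₂ (only v uv) eq
    where
    case₁ : ∀ {y} → y ≡ a ⊎ y ≡ b → ¬ Contains u y → inj₁ y ≡ towards u a ⊎ inj₁ y ≡ towards u b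
    case₁ (inj₁ refl) ¬c = inj₁ (sym (towards-old ¬c))
    case₁ (inj₂ refl) ¬c = inj₂ (sym (towards-old ¬c))
    case₂ : ∀ {v k} → v ≡ a ⊎ v ≡ b → edge k ≡ (u , v) ⊎ edge k ≡ (v , u) →
            inj₂ k ≡ towards u a ⊎ inj₂ k ≡ towards u b
    case₂ (inj₁ refl) eq = inj₁ (sym (towards-new eq))
    case₂ (inj₂ refl) eq = inj₂ (sym (towards-new eq))

  subdivide-order≤3*γ : MaxDegree2 (Adj G) → n + q ≤ 3 * γ (subdivide G F)
  subdivide-order≤3*γ deg = order≤3*γ (subdivide G F) deg′
    where
    back : ∀ y {z} → splitAt n y ≡ z → y ≡ join n q z
    back y e = trans (sym (Fin.join-splitAt n q y)) (cong (join n q) e)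
    deg′ : MaxDegree2 (Adj (subdivide G F))
    deg′ x with subdivide-maxDegree2 deg (splitAt n x)
    ... | a , b , only = join n q a , join n q b , λ y xy → Sum.map (back y) (back y) (only _ xy)

-- Every third vertex of a walk dominates it.  Steps may stand still, so that
-- a finite walk can be continued forever.
walk-covers : ∀ {A : Set} {R : Rel A 0ℓ} → Symmetric R → ∀ m (p : ℕ → A) →
  (∀ j → p j ≡ p (suc j) ⊎ R (p j) (p (suc j))) → (∀ x → ∃[ j ] (j < 3 * m × p j ≡ x)) →
  ∃[ xs ] (Covers R xs × length xs ≡ m)
walk-covers {A} {R} R-sym m p step all = xs , cov , List.length-applyUpTo _ m
  where
  -- Positions are grouped in blocks of three and `1 + 3 * i` is the centre of block `i`. The last
  -- centre may lie past the first visits to all vertices, where `p` is still defined.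
  middle : ℕ → A
  middle i = p (1 + 3 * i)
  xs : List A
  xs = applyUpTo middle m
  nearest : ∀ m j → j < 3 * m → ∃[ i ] (i < m × (suc j ≡ 1 + 3 * i ⊎ j ≡ 1 + 3 * i ⊎ j ≡ 2 + 3 * i))
  nearest (suc m) j j< rewrite ℕ.*-suc 3 m with j
  ... | 0 = 0 , s≤s z≤n , inj₁ refl
  ... | 1 = 0 , s≤s z≤n , inj₂ (inj₁ refl)
  ... | 2 = 0 , s≤s z≤n , inj₂ (inj₂ refl)
  ... | suc (suc (suc j)) with nearest m j (ℕ.+-cancelˡ-< 3 j (3 * m) j<)
  ...   | i , i< , eqs = suc i , s≤s i< , shifted eqs
    where
    shifted : suc j ≡ 1 + 3 * i ⊎ j ≡ 1 + 3 * i ⊎ j ≡ 2 + 3 * i →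
              4 + j ≡ 1 + 3 * suc i ⊎ 3 + j ≡ 1 + 3 * suc i ⊎ 3 + j ≡ 2 + 3 * suc i
    shifted e rewrite ℕ.*-suc 3 i =
      Sum.map (cong (3 +_)) (Sum.map (cong (3 +_)) (cong (3 +_))) e
  cov : Covers R xs
  cov x with all x
  ... | j , j< , refl with nearest m j j<
  ...   | i , i< , eqs = middle i , ∈-applyUpTo⁺ middle i< , near eqs
    where
    near : suc j ≡ 1 + 3 * i ⊎ j ≡ 1 + 3 * i ⊎ j ≡ 2 + 3 * i → p j ≡ middle i ⊎ R (p j) (middle i)
    near (inj₁ refl)        = step j
    near (inj₂ (inj₁ refl)) = inj₁ refl
    near (inj₂ (inj₂ refl)) = Sum.map sym R-sym (step (1 + 3 * i))

-- Trails, components and spanning paths in trees.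

module _ {n : ℕ} (G : Graph n) where

  infixr 5 _,_◂_

  -- Trail x xs: x ∷ xs is a path in G.
  data Trail : Fin n → List (Fin n) → Set where
    stop  : ∀ {x} → Trail x []
    _,_◂_ : ∀ {x y ys} → Adj G x y → x ∉ y ∷ ys → Trail y ys → Trail x (y ∷ ys)

  last : Fin n → List (Fin n) → Fin n
  last x []       = x
  last x (y ∷ ys) = last y ys

  last-∈ : ∀ x xs → last x xs ∈ x ∷ xs
  last-∈ x []       = here refl
  last-∈ x (y ∷ ys) = there (last-∈ y ys)

  lookup-injective : ∀ {x xs} → Trail x xs → Injective _≡_ _≡_ (lookup (x ∷ xs))
  lookup-injective t {zero} {zero} e = refl
  lookup-injective {xs = _ ∷ _} (_ , x∉ ◂ _) {zero} {suc j} e =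
    contradiction (subst (_∈ _) (sym e) (∈-lookup j)) x∉
  lookup-injective {xs = _ ∷ _} (_ , x∉ ◂ _) {suc i} {zero} e =
    contradiction (subst (_∈ _) e (∈-lookup i)) x∉
  lookup-injective {xs = _ ∷ _} (_ , _ ◂ t) {suc i} {suc j} e = cong suc (lookup-injective t e)

  length≤order : ∀ {x xs} → Trail x xs → suc (length xs) ≤ n
  length≤order t = Fin.injective⇒≤ (lookup-injective t)

  lookup-step : ∀ {x xs} → Trail x xs → ∀ i →
                Adj G (lookup (x ∷ xs) (inject₁ i)) (lookup (x ∷ xs) (suc i))
  lookup-step (xy , _ ◂ _) zero    = xy
  lookup-step (_ , _ ◂ t)  (suc i) = lookup-step t i

  lookup-last : ∀ x xs → lookup (x ∷ xs) (fromℕ (length xs)) ≡ last x xs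
  lookup-last x []       = refl
  lookup-last x (y ∷ ys) = lookup-last y ys

  prefix : ∀ {x xs z} → Trail x xs → z ∈ xs →
           ∃₂ λ y ys → Trail x (y ∷ ys) × last y ys ≡ z × (∀ {w} → w ∈ y ∷ ys → w ∈ xs)
  prefix (xy , x∉ ◂ t) (here refl) =
    _ , [] , (xy , (λ { (here e) → x∉ (here e) }) ◂ stop) , refl , λ { (here e) → here e }
  prefix (xy , x∉ ◂ t) (there z∈) with prefix t z∈
  ... | y , ys , t′ , e , sub = _ , y ∷ ys , (xy , x∉ ∘ sub′ ◂ t′) , e , sub′
    where
    sub′ : ∀ {w} → w ∈ _ ∷ y ∷ ys → w ∈ _ ∷ _
    sub′ (here e)  = here e
    sub′ (there e) = there (sub e)

  suffix : ∀ {x xs z} → Trail x xs → z ∈ x ∷ xs →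
           ∃[ zs ] (Trail z zs × last z zs ≡ last x xs × (∀ {w} → w ∈ z ∷ zs → w ∈ x ∷ xs))
  suffix t (here refl) = _ , t , refl , λ e → e
  suffix (_ , _ ◂ t) (there z∈) with suffix t z∈
  ... | zs , t′ , e , sub = zs , t′ , e , there ∘ sub

  -- The edge from `z` to `x` closes the part of the trail up to `z`. Since `z` comes after `y`,
  -- that part has at least three vertices.
  chord⇒cycle : ∀ {x y ys z} → Trail x (y ∷ ys) → z ∈ ys → Adj G z x → Cycle G
  chord⇒cycle (xy , x∉ ◂ t) z∈ zx with prefix t z∈
  ... | w , ws , t′ , refl , sub = record
    { vertex   = lookup (_ ∷ _ ∷ w ∷ ws)
    ; distinct = lookup-injective whole
    ; steps    = lookup-step whole
    ; closing  = subst (λ u → Adj G u _) (sym (lookup-last w ws)) zx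
    }
    where
    whole = xy , (λ { (here e) → x∉ (here e) ; (there e) → x∉ (there (sub e)) }) ◂ t′

  -- Connectivity in `G - v`. Only the steps are constrained, so the empty walk at `v` is included
  -- and `b ≢ v` is demanded separately below.
  Avoiding : Fin n → Rel (Fin n) 0ℓ
  Avoiding v = Star λ x y → Adj G x y × x ≢ v × y ≢ v

  avoiding-sym : ∀ {v} → Symmetric (Avoiding v)
  avoiding-sym = reverse λ (xy , x≢ , y≢) → adjSym G xy , y≢ , x≢

  -- If the new first vertex already occurs on the trail built from the rest of the walk, everything
  -- before that occurrence is dropped.
  eraseLoops : ∀ {v b c} → b ≢ v → Avoiding v b c →
               ∃[ zs ] (Trail b zs × last b zs ≡ c × v ∉ b ∷ zs)
  eraseLoops b≢v ε = [] , stop , refl , λ { (here e) → b≢v (sym e) }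
  eraseLoops {b = b} b≢v ((by , _ , y≢v) ◅ walk) with eraseLoops y≢v walk
  ... | zs , t , e , v∉ with member? Fin._≟_ b (_ ∷ zs)
  ...   | no b∉  = _ , (by , b∉ ◂ t) , e , λ { (here e) → b≢v (sym e) ; (there e) → v∉ e }
  ...   | yes b∈ with suffix t b∈
  ...     | zs′ , t′ , e′ , sub = zs′ , t′ , trans e′ e , v∉ ∘ sub

  module _ (acyclic : ¬ Cycle G) where

    -- Otherwise a trail from `b` to `c` off `v`, with `v` put in front, would have its last vertex
    -- adjacent to its first and close a cycle.
    neighbours-separated : ∀ {v b c} → Adj G v b → Adj G v c → Avoiding v b c → b ≡ c
    neighbours-separated {v} {b} {c} vb vc walk
      with eraseLoops (λ { refl → irrefl G refl vb }) walk
    ... | []     , t , e    , v∉ = e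
    ... | z ∷ zs , t , refl , v∉ =
      contradiction (chord⇒cycle (vb , v∉ ◂ t) (last-∈ z zs) (adjSym G vc)) acyclic

    -- The component of G - v containing x is identified by the neighbour of v in it.
    record Components (v : Fin n) : Set where
      field
        comp     : Fin n → Fin n
        comp-v   : comp v ≡ v
        comp-nbr : ∀ {x} → x ≢ v → Adj G v (comp x)
        comp-adj : ∀ {x y} → x ≢ v → y ≢ v → Adj G x y → comp x ≡ comp y
        comp-fix : ∀ {b} → Adj G v b → comp b ≡ b

    -- `c` is the vertex just before the walk first reaches `v`.
    firstHit : ∀ {v x} → x ≢ v → Star (Adj G) x v → ∃[ c ] (Adj G v c × Avoiding v x c)
    firstHit x≢v ε = contradiction refl x≢v
    firstHit {v} x≢v (_◅_ {j = y} xy walk) with y Fin.≟ v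
    ... | yes refl = _ , adjSym G xy , ε
    ... | no y≢v with firstHit y≢v walk
    ...   | c , vc , walk′ = c , vc , (xy , x≢v , y≢v) ◅ walk′

    -- `comp x` is read off the walk that `connected` happens to supply. By `neighbours-separated`
    -- the result does not depend on the walk, hence is constant along edges off `v`.
    components : Connected G → ∀ v → Components v
    components connected v = record
      { comp     = comp
      ; comp-v   = comp-v
      ; comp-nbr = λ x≢v → proj₁ (comp-spec x≢v)
      ; comp-adj = λ x≢v y≢v xy → neighbours-separated (proj₁ (comp-spec x≢v)) (proj₁ (comp-spec y≢v))
                     (avoiding-sym (proj₂ (comp-spec x≢v)) ◅◅ (xy , x≢v , y≢v) ◅ proj₂ (comp-spec y≢v))
      ; comp-fix = λ vb → let b≢v = λ { refl → irrefl G refl vb } in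
                     sym (neighbours-separated vb (proj₁ (comp-spec b≢v)) (proj₂ (comp-spec b≢v)))
      }
      where
      comp : Fin n → Fin n
      comp x with x Fin.≟ v
      ... | yes _  = v
      ... | no x≢v = proj₁ (firstHit x≢v (connected x v))
      comp-v : comp v ≡ v
      comp-v with v Fin.≟ v
      ... | yes _  = refl
      ... | no v≢v = contradiction refl v≢v
      comp-spec : ∀ {x} → x ≢ v → Adj G v (comp x) × Avoiding v x (comp x)
      comp-spec {x} x≢v with x Fin.≟ v
      ... | yes e   = contradiction e x≢v
      ... | no x≢v′ = proj₂ (firstHit x≢v′ (connected x v))

    -- An adjacency between positions two or more apart would be a chord.
    consecutive : ∀ {x xs} → Trail x xs → ∀ i j → Adj G (lookup (x ∷ xs) i) (lookup (x ∷ xs) j) →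
                  suc (toℕ i) ≡ toℕ j ⊎ suc (toℕ j) ≡ toℕ i
    consecutive t zero zero xx = contradiction xx (irrefl G refl)
    consecutive {xs = _ ∷ _} t zero (suc zero) _ = inj₁ refl
    consecutive {xs = _ ∷ _} t (suc zero) zero _ = inj₂ refl
    consecutive {xs = _ ∷ _} t zero (suc (suc j)) e =
      contradiction (chord⇒cycle t (∈-lookup j) (adjSym G e)) acyclic
    consecutive {xs = _ ∷ _} t (suc (suc i)) zero e =
      contradiction (chord⇒cycle t (∈-lookup i) e) acyclic
    consecutive {xs = _ ∷ _} (_ , _ ◂ t) (suc i) (suc j) e =
      Sum.map (cong suc) (cong suc) (consecutive t i j e)

    consecutive⇒adj : ∀ {x xs} → Trail x xs → ∀ i j → suc (toℕ i) ≡ toℕ j →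
                      Adj G (lookup (x ∷ xs) i) (lookup (x ∷ xs) j)
    consecutive⇒adj t i zero ()
    consecutive⇒adj {x} {xs} t i (suc j) e =
      subst (λ k → Adj G (lookup (x ∷ xs) k) (lookup xs j))
        (Fin.toℕ-injective (trans (Fin.toℕ-inject₁ j) (sym (ℕ.suc-injective e))))
        (lookup-step t j)

    hamiltonian⇒≅ : ∀ {x xs} → Trail x xs → (∀ y → y ∈ x ∷ xs) → G ≅ Path (suc (length xs))
    hamiltonian⇒≅ {x} {xs} t all = record
      { vertices = mk↔ₛ′ pos (lookup (x ∷ xs)) pos-lookup lookup-pos
      ; adjacent = λ u v → mk⇔
          (λ uv → consecutive t (pos u) (pos v)
            (subst₂ (Adj G) (sym (lookup-pos u)) (sym (lookup-pos v)) uv))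
          (λ e → subst₂ (Adj G) (lookup-pos u) (lookup-pos v) (adj e))
      }
      where
      pos : Fin n → Fin (suc (length xs))
      pos y = Any.index (all y)
      lookup-pos : ∀ y → lookup (x ∷ xs) (pos y) ≡ y
      lookup-pos y = sym (lookup-index (all y))
      pos-lookup : ∀ i → pos (lookup (x ∷ xs) i) ≡ i
      pos-lookup i = lookup-injective t (lookup-pos _)
      adj : ∀ {i j} → Adj (Path _) i j → Adj G (lookup (x ∷ xs) i) (lookup (x ∷ xs) j)
      adj (inj₁ e) = consecutive⇒adj t _ _ e
      adj (inj₂ e) = adjSym G (consecutive⇒adj t _ _ e)

    Stuck : Fin n → List (Fin n) → Set
    Stuck x xs = ∀ y → Adj G x y → y ∈ x ∷ xs

    -- A trail has at most n vertices, so the fuel f suffices.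
    grow : ∀ f {x xs} → n < suc (length xs) + f → Trail x xs →
           ∃₂ λ y ys → Trail y ys × Stuck y ys × last y ys ≡ last x xs
    grow zero {xs = xs} n< t =
      contradiction (length≤order t) (ℕ.<⇒≱ (subst (n <_) (ℕ.+-identityʳ _) n<))
    grow (suc f) {x} {xs} n< t
      with Fin.any? (λ y → adj? G x y ×-dec ¬? (member? Fin._≟_ y (x ∷ xs)))
    ... | yes (y , xy , y∉) = grow f (subst (n <_) (ℕ.+-suc _ f) n<) (adjSym G xy , y∉ ◂ t)
    ... | no stuck = x , xs , t , stuck′ , refl
      where
      stuck′ : Stuck x xs
      stuck′ y xy with member? Fin._≟_ y (x ∷ xs)
      ... | yes y∈ = y∈
      ... | no y∉  = contradiction (y , xy , y∉) stuck

    AtMostTwoNeighbours : Set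
    AtMostTwoNeighbours = ∀ {v a b c} → Adj G v a → Adj G v b → Adj G v c → a ≡ b ⊎ a ≡ c ⊎ b ≡ c

    module _ (connected : Connected G) (two : AtMostTwoNeighbours) where

      -- All neighbours of the first vertex lie on the trail, and any beyond the second vertex would
      -- close a cycle.
      stuck⇒leaf : ∀ {x xs} → Trail x xs → Stuck x xs → ∀ {y z} → Adj G x y → Adj G x z → y ≡ z
      stuck⇒leaf {x} {xs} t stuck xy xz = trans (first t xy (stuck _ xy)) (sym (first t xz (stuck _ xz)))
        where
        -- `last x (take 1 xs)` is the second vertex of the trail. It defaults to `x` when there is
        -- none, a case that irreflexivity excludes.
        first : ∀ {xs y} → Trail x xs → Adj G x y → y ∈ x ∷ xs → y ≡ last x (take 1 xs)
        first t xy (here refl)                = contradiction xy (irrefl G refl)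
        first t xy (there (here e))           = e
        first {_ ∷ _} t xy (there (there y∈)) = contradiction (chord⇒cycle t y∈ (adjSym G xy)) acyclic

      -- `w` is the predecessor of `x`. An inner vertex has its predecessor and its successor as two
      -- distinct neighbours, so no third one leads off the trail; at the last vertex `leaf` takes
      -- over.
      tail-closed : ∀ {w x xs} → Adj G x w → w ∉ x ∷ xs → Trail x xs →
        (∀ {y z} → Adj G (last x xs) y → Adj G (last x xs) z → y ≡ z) →
        ∀ {u z} → u ∈ x ∷ xs → Adj G u z → z ∈ w ∷ x ∷ xs
      tail-closed xw w∉ stop leaf (here refl) uz = here (leaf uz xw)
      tail-closed xw w∉ (xy , x∉ ◂ t) leaf (there u∈) uz =
        there (tail-closed (adjSym G xy) x∉ t leaf u∈ uz)
      tail-closed xw w∉ (xy , x∉ ◂ t) leaf (here refl) uz with two xw xy uz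
      ... | inj₁ refl        = contradiction (there (here refl)) w∉
      ... | inj₂ (inj₁ refl) = here refl
      ... | inj₂ (inj₂ refl) = there (there (here refl))

      -- A trail grown from `v` until stuck starts at a vertex `h` with at most one neighbour. One
      -- grown from `h` until stuck then has such vertices at both ends, so its vertex set is closed
      -- under adjacency and, by connectedness, is everything.
      hamiltonian : Fin n → ∃₂ λ x xs → Trail x xs × (∀ y → y ∈ x ∷ xs)
      hamiltonian v with grow n {v} ℕ.≤-refl stop
      ... | h , hs , t , h-stuck , _ with grow n {h} ℕ.≤-refl stop
      ...   | x , xs , t′ , x-stuck , last≡h = x , xs , t′ , λ y → reach (connected x y) (here refl)
        where
        closed : ∀ {x xs} → Trail x xs → Stuck x xs → last x xs ≡ h →
                 ∀ {u z} → u ∈ x ∷ xs → Adj G u z → z ∈ x ∷ xs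
        closed t stuck e (here refl) uz = stuck _ uz
        closed (xy , x∉ ◂ t″) stuck refl (there u∈) uz =
          tail-closed (adjSym G xy) x∉ t″ (stuck⇒leaf t h-stuck) u∈ uz
        reach : ∀ {u y} → Star (Adj G) u y → u ∈ x ∷ xs → y ∈ x ∷ xs
        reach ε u∈           = u∈
        reach (uz ◅ walk) u∈ = reach walk (closed t′ x-stuck last≡h u∈ uz)

      ≅Path : Fin n → ∃[ m ] (G ≅ Path m)
      ≅Path v with hamiltonian v
      ... | x , xs , t , all = _ , hamiltonian⇒≅ t all

-- Small edge sets, and paths as vertex sequences.

module _ {V : Set} where

  Joins : V × V → V → V → Set
  Joins e u v = e ≡ (u , v) ⊎ e ≡ (v , u)

  joins-match : ∀ {e u v x y} → Joins e u v → Joins e x y → (x ≡ u × y ≡ v) ⊎ (y ≡ u × x ≡ v)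
  joins-match (inj₁ refl) (inj₁ refl) = inj₁ (refl , refl)
  joins-match (inj₁ refl) (inj₂ refl) = inj₂ (refl , refl)
  joins-match (inj₂ refl) (inj₁ refl) = inj₂ (refl , refl)
  joins-match (inj₂ refl) (inj₂ refl) = inj₁ (refl , refl)

  joins-unique : ∀ {e u v w} → u ≢ v → Joins e u v → Joins e u w → v ≡ w
  joins-unique u≢v j j′ with joins-match j j′
  ... | inj₁ (_ , refl) = refl
  ... | inj₂ (_ , refl) = contradiction refl u≢v

  joins-start : ∀ {e u v} → Joins e u v → u ≡ proj₁ e ⊎ u ≡ proj₂ e
  joins-start (inj₁ refl) = inj₁ refl
  joins-start (inj₂ refl) = inj₂ refl

  joins-ends : ∀ {e u v x} → Joins e u v → x ≡ proj₁ e ⊎ x ≡ proj₂ e → x ≡ u ⊎ x ≡ v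
  joins-ends (inj₁ refl) x≡ = x≡
  joins-ends (inj₂ refl) x≡ = swap x≡

module _ {n : ℕ} (G : Graph n) where

  orient : ∀ {u v} → Adj G u v →
           ∃[ e ] (Joins e u v × proj₁ e <ᶠ proj₂ e × Adj G (proj₁ e) (proj₂ e))
  orient {u} {v} uv with Fin.<-cmp u v
  ... | tri< u<v _ _  = (u , v) , inj₁ refl , u<v , uv
  ... | tri≈ _ refl _ = contradiction uv (irrefl G refl)
  ... | tri> _ _ v<u  = (v , u) , inj₂ refl , v<u , adjSym G uv

  singleEdge : ∀ {u v} → Adj G u v → ∃[ F ] Joins (EdgeSet.edge {G = G} {1} F zero) u v
  singleEdge uv with orient uv
  ... | e , j , lt , adj = record
    { edge = λ _ → e ; ordered = λ _ → lt ; isEdge = λ _ → adj ; injective = λ { {zero} {zero} _ → refl } } , j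

  twoEdges : ∀ {v b c} → Adj G v b → Adj G v c → b ≢ c →
    ∃[ F ] (Joins (EdgeSet.edge {G = G} {2} F zero) v b × Joins (EdgeSet.edge F (suc zero)) v c)
  twoEdges {v} {b} {c} vb vc b≢c with orient vb | orient vc
  ... | e , j , lt , adj | e′ , j′ , lt′ , adj′ = record
    { edge      = pairOf
    ; ordered   = λ { zero → lt ; (suc zero) → lt′ }
    ; isEdge    = λ { zero → adj ; (suc zero) → adj′ }
    ; injective = injective
    } , j , j′
    where
    v≢b : v ≢ b
    v≢b refl = irrefl G refl vb
    pairOf : Fin 2 → Fin n × Fin n
    pairOf zero       = e
    pairOf (suc zero) = e′
    injective : Injective _≡_ _≡_ pairOf
    injective {zero}     {zero}     _ = refl
    injective {zero}     {suc zero} p =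
      contradiction (joins-unique v≢b j (subst (λ f → Joins f v c) (sym p) j′)) b≢c
    injective {suc zero} {zero}     p =
      contradiction (joins-unique v≢b j (subst (λ f → Joins f v c) p j′)) b≢c
    injective {suc zero} {suc zero} _ = refl

  -- A Hamiltonian path, indexed by position and standing still after its end.
  record Spine : Set where
    field
      at       : ℕ → Fin n
      pos      : Fin n → ℕ
      at-pos   : ∀ x → at (pos x) ≡ x
      pos-at   : ∀ {j} → j < n → pos (at j) ≡ j
      pos<     : ∀ x → pos x < n
      step     : ∀ j → (suc j < n × Adj G (at j) (at (suc j))) ⊎ at j ≡ at (suc j)
      adj-step : ∀ {j} → suc j < n → Adj G (at j) (at (suc j))
      adj-pos  : ∀ {x y} → Adj G x y → suc (pos x) ≡ pos y ⊎ suc (pos y) ≡ pos x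

-- Truncation at `m`, which makes a vertex sequence stand still past its end.
clamp : ∀ {m} → ℕ → Fin (suc m)
clamp         zero    = zero
clamp {zero}  (suc j) = zero
clamp {suc m} (suc j) = suc (clamp j)

toℕ-clamp : ∀ {m j} → j < suc m → toℕ (clamp {m} j) ≡ j
toℕ-clamp {j = zero}          _        = refl
toℕ-clamp {suc m} {j = suc j} (s≤s j<) = cong suc (toℕ-clamp j<)
toℕ-clamp {zero}  {j = suc j} (s≤s ())

clamp-stop : ∀ {m j} → m ≤ j → clamp {m} j ≡ clamp {m} (suc j)
clamp-stop {zero} {zero}   _        = refl
clamp-stop {zero} {suc j}  _        = refl
clamp-stop {suc m} {suc j} (s≤s m≤) = cong suc (clamp-stop m≤)

≅⇒order≡ : ∀ {m n} {G : Graph m} {H : Graph n} → G ≅ H → m ≡ n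
≅⇒order≡ G≅H = Fin.cantor-schröder-bernstein {f = to} {g = from}
    (λ {x} {y} e → trans (sym (strictlyInverseʳ x)) (trans (cong from e) (strictlyInverseʳ y)))
    (λ {x} {y} e → trans (sym (strictlyInverseˡ x)) (trans (cong to e) (strictlyInverseˡ y)))
  where open Inverse (_≅_.vertices G≅H)

≅Path⇒spine : ∀ {n} {G : Graph (suc n)} → G ≅ Path (suc n) → Spine G
≅Path⇒spine {n} {G} G≅P = record
  { at       = at
  ; pos      = λ x → toℕ (to x)
  ; at-pos   = λ x → trans (cong from (Fin.toℕ-injective (toℕ-clamp (Fin.toℕ<n (to x))))) (strictlyInverseʳ x)
  ; pos-at   = λ j< → trans (cong toℕ (strictlyInverseˡ _)) (toℕ-clamp j<)
  ; pos<     = λ x → Fin.toℕ<n (to x)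
  ; step     = λ j → step j (ℕ.<-≤-connex j n)
  ; adj-step = adj-step
  ; adj-pos  = λ {x} {y} → Equivalence.to (_≅_.adjacent G≅P x y)
  }
  where
  open Inverse (_≅_.vertices G≅P)
  at : ℕ → Fin (suc n)
  at j = from (clamp j)
  adj-step : ∀ {j} → suc j < suc n → Adj G (at j) (at (suc j))
  adj-step {j} sj< = Equivalence.from (_≅_.adjacent G≅P (at j) (at (suc j)))
    (inj₁ (trans (cong (suc ∘ toℕ) (strictlyInverseˡ _))
      (trans (cong suc (toℕ-clamp (ℕ.<-trans (ℕ.n<1+n j) sj<)))
        (sym (trans (cong toℕ (strictlyInverseˡ _)) (toℕ-clamp sj<))))))
  step : ∀ j → j < n ⊎ n ≤ j → (suc j < suc n × Adj G (at j) (at (suc j))) ⊎ at j ≡ at (suc j)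
  step j (inj₁ j<n) = inj₁ (s≤s j<n , adj-step (s≤s j<n))
  step j (inj₂ n≤j) = inj₂ (cong from (clamp-stop n≤j))

-- Upper bounds on domination in subdivided paths.

-- `w` lands at index `suc i`, between `p i` and `p (suc i)`, as the new vertex of that edge.
insert : {A B : Set} → ℕ → B → (ℕ → A) → ℕ → A ⊎ B
insert i       w p zero          = inj₁ (p 0)
insert zero    w p (suc zero)    = inj₂ w
insert zero    w p (suc (suc j)) = inj₁ (p (suc j))
insert (suc i) w p (suc j)       = insert i w (p ∘ suc) j

module _ {A B : Set} {w : B} where

  insert-new : ∀ i (p : ℕ → A) → insert i w p (suc i) ≡ inj₂ w
  insert-new zero    p = refl
  insert-new (suc i) p = insert-new i (p ∘ suc)

  insert-old : ∀ i (p : ℕ → A) j → ∃[ l ] (l ≤ suc j × insert i w p l ≡ inj₁ (p j))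
  insert-old i       p zero    = 0 , z≤n , refl
  insert-old zero    p (suc j) = suc (suc j) , ℕ.≤-refl , refl
  insert-old (suc i) p (suc j) with insert-old i (p ∘ suc) j
  ... | l , l≤ , e = suc l , s≤s l≤ , e

  insert-step : ∀ {R : Rel (A ⊎ B) 0ℓ} i (p : ℕ → A) →
    (∀ {j} → j < i → R (inj₁ (p j)) (inj₁ (p (suc j)))) →
    R (inj₁ (p i)) (inj₂ w) → R (inj₂ w) (inj₁ (p (suc i))) →
    (∀ {j} → i < j → R (inj₁ (p j)) (inj₁ (p (suc j)))) →
    ∀ j → R (insert i w p j) (insert i w p (suc j))
  insert-step zero    p before in-w out after zero          = in-w
  insert-step zero    p before in-w out after (suc zero)    = out
  insert-step zero    p before in-w out after (suc (suc j)) = after (s≤s z≤n)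
  insert-step (suc zero) p before in-w out after zero = before (s≤s z≤n)
  insert-step (suc (suc i)) p before in-w out after zero = before (s≤s z≤n)
  insert-step {R} (suc i) p before in-w out after (suc j) =
    insert-step {R} i (p ∘ suc) (before ∘ s≤s) in-w out (after ∘ s≤s) j

module _ {n : ℕ} {G : Graph n} (S : Spine G) where
  open Spine S

  spine-maxDegree2 : MaxDegree2 (Adj G)
  spine-maxDegree2 x = at (pred (pos x)) , at (suc (pos x)) , λ y xy → case (adj-pos xy)
    where
    case : ∀ {y} → suc (pos x) ≡ pos y ⊎ suc (pos y) ≡ pos x → y ≡ at (pred (pos x)) ⊎ y ≡ at (suc (pos x))
    case {y} (inj₁ e) = inj₂ (trans (sym (at-pos y)) (cong at (sym e)))
    case {y} (inj₂ e) = inj₁ (trans (sym (at-pos y)) (cong (at ∘ pred) e))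

  spine-γ≤ : ∀ m → n ≤ 3 * m → γ G ≤ m
  spine-γ≤ m n≤ with walk-covers (adjSym G) m at
      (λ j → swap (Sum.map proj₂ (λ e → e) (step j)))
      (λ x → pos x , ℕ.<-≤-trans (pos< x) n≤ , at-pos x)
  ... | xs , cov , refl = γ≤length G cov

  module _ {q} (F : EdgeSet G q) where
    open EdgeSet F

    Step : Rel (Fin n ⊎ Fin q) 0ℓ
    Step x y = x ≡ y ⊎ SubdividedAdj G F x y

    kept-step : ∀ j → (suc j < n → ¬ Contains (at j) (at (suc j))) → Step (inj₁ (at j)) (inj₁ (at (suc j)))
    kept-step j ¬c with step j
    ... | inj₁ (sj< , adj) = inj₂ (adj , ¬c sj<)
    ... | inj₂ e           = inj₁ (cong inj₁ e)

    subdivide-walk-γ≤ : ∀ m (p : ℕ → Fin n ⊎ Fin q) → (∀ j → Step (p j) (p (suc j))) →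
      (∀ x → ∃[ j ] (j < 3 * m × p j ≡ x)) → γ (subdivide G F) ≤ m
    subdivide-walk-γ≤ m p steps all
      with walk-covers (λ {x} {y} → subdividedAdj-sym G F {x} {y}) m p steps all
    ... | xs , cov , refl = subdivide-γ≤length G F cov

  -- An edge of a path joins consecutive positions, so inserting its new vertex there gives a
  -- spanning walk on `n + 1` vertices. The two cases of `go` are the two orientations.
  spine-γ₁≤ : ∀ (F : EdgeSet G 1) m → n < 3 * m → γ (subdivide G F) ≤ m
  spine-γ₁≤ F m n< = go (adj-pos (isEdge zero))
    where
    open EdgeSet F
    u v : Fin n
    u = proj₁ (edge zero)
    v = proj₂ (edge zero)
    walk : ∀ i → suc i < n → EndpointOf (at i) zero → EndpointOf (at (suc i)) zero →
           (∀ {x} → EndpointOf x zero → pos x ≡ i ⊎ pos x ≡ suc i) → γ (subdivide G F) ≤ m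
    walk i si< end end′ ends = subdivide-walk-γ≤ F m (insert i zero at)
      (insert-step {R = Step F} i at
        (λ {j} j<i → kept-step F j λ sj< c → before j<i (ℕ.<-trans (ℕ.n<1+n j) sj<) (contains-endpoint G F c))
        (inj₂ end) (inj₂ end′)
        (λ {j} i<j → kept-step F j λ sj< c → after i<j sj< (contains-endpoint G F c)))
      all
      where
      -- An edge further left has its left end outside positions `i` and `suc i`, and one further
      -- right its right end; so neither is subdivided.
      before : ∀ {j y} → j < i → j < n → ∃[ k ] (EndpointOf (at j) k × EndpointOf y k) → ⊥
      before j<i j<n (zero , e , _) with ends e
      ... | inj₁ p = ℕ.<⇒≢ j<i (trans (sym (pos-at j<n)) p)
      ... | inj₂ p = ℕ.<⇒≢ (ℕ.<-trans j<i (ℕ.n<1+n i)) (trans (sym (pos-at j<n)) p)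
      after : ∀ {j x} → i < j → suc j < n → ∃[ k ] (EndpointOf x k × EndpointOf (at (suc j)) k) → ⊥
      after i<j sj<n (zero , _ , e) with ends e
      ... | inj₁ p = ℕ.>⇒≢ (ℕ.<-trans i<j (ℕ.n<1+n _)) (trans (sym (pos-at sj<n)) p)
      ... | inj₂ p = ℕ.>⇒≢ (s≤s i<j) (trans (sym (pos-at sj<n)) p)
      all : ∀ x → ∃[ j ] (j < 3 * m × insert i zero at j ≡ x)
      all (inj₂ zero) = suc i , ℕ.<-trans si< n< , insert-new i at
      all (inj₁ x) with insert-old {w = zero} i at (pos x)
      ... | l , l≤ , e = l , ℕ.≤-<-trans (ℕ.≤-trans l≤ (pos< x)) n< , trans e (cong inj₁ (at-pos x))
    go : suc (pos u) ≡ pos v ⊎ suc (pos v) ≡ pos u → γ (subdivide G F) ≤ m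
    go (inj₁ e) = walk (pos u) (subst (_< n) (sym e) (pos< v)) (inj₁ (at-pos u))
      (inj₂ (trans (cong at e) (at-pos v))) λ { (inj₁ refl) → inj₁ refl ; (inj₂ refl) → inj₂ (sym e) }
    go (inj₂ e) = walk (pos v) (subst (_< n) (sym e) (pos< u)) (inj₂ (at-pos v))
      (inj₁ (trans (cong at e) (at-pos u))) λ { (inj₁ refl) → inj₂ (sym e) ; (inj₂ refl) → inj₁ refl }

  -- The witness subdivides the first two edges, which meet in `at 1`. The resulting path is written
  -- out up to its fifth vertex and then follows `at`.
  spine-γ₂≤ : ∀ m → 2 < n → 2 + n ≤ 3 * m → ∃[ F ] (γ (subdivide {q = 2} G F) ≤ m)
  spine-γ₂≤ m 2<n 2+n≤ with twoEdges G (adjSym G (adj-step 1<n)) (adj-step 2<n) at0≢at2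
    where
    1<n : 1 < n
    1<n = ℕ.<-trans (ℕ.n<1+n 1) 2<n
    at0≢at2 : at 0 ≢ at 2
    at0≢at2 e = contradiction (trans (sym (pos-at (ℕ.<-trans (s≤s z≤n) 1<n))) (trans (cong pos e) (pos-at 2<n))) λ ()
  ... | F , j₀ , j₁ = F , subdivide-walk-γ≤ F m walk steps all
    where
    open EdgeSet F
    walk : ℕ → Fin n ⊎ Fin 2
    walk 0 = inj₁ (at 0)
    walk 1 = inj₂ zero
    walk 2 = inj₁ (at 1)
    walk 3 = inj₂ (suc zero)
    walk (suc (suc (suc (suc j)))) = inj₁ (at (2 + j))
    distinct : ∀ {i j} → i ≤ 2 → 3 + j < n → at (3 + j) ≢ at i
    distinct i≤2 lt e = ℕ.>⇒≢ (ℕ.≤-trans (s≤s i≤2) (ℕ.m≤m+n 3 _))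
      (trans (sym (pos-at lt)) (trans (cong pos e) (pos-at (ℕ.≤-<-trans i≤2 2<n))))
    late : ∀ {j k} → 3 + j < n → ¬ EndpointOf (at (3 + j)) k
    late {k = zero} lt e with joins-ends j₀ e
    ... | inj₁ p = distinct (s≤s z≤n) lt p
    ... | inj₂ p = distinct z≤n lt p
    late {k = suc zero} lt e with joins-ends j₁ e
    ... | inj₁ p = distinct (s≤s z≤n) lt p
    ... | inj₂ p = distinct ℕ.≤-refl lt p
    steps : ∀ j → Step F (walk j) (walk (suc j))
    steps 0 = inj₂ (joins-start (swap j₀))
    steps 1 = inj₂ (joins-start j₀)
    steps 2 = inj₂ (joins-start j₁)
    steps 3 = inj₂ (joins-start (swap j₁))
    -- From here on each step has its right end at position three or later, away from both
    -- subdivided edges.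
    steps (suc (suc (suc (suc j)))) = kept-step F (2 + j) λ lt c →
      late lt (proj₂ (proj₂ (contains-endpoint G F c)))
    old : ∀ j → j < n → ∃[ l ] (l < 2 + n × walk l ≡ inj₁ (at j))
    old 0 j< = 0 , s≤s z≤n , refl
    old 1 j< = 2 , s≤s (s≤s (ℕ.<-trans (s≤s z≤n) j<)) , refl
    old (suc (suc j)) j< = 4 + j , s≤s (s≤s j<) , refl
    all : ∀ x → ∃[ j ] (j < 3 * m × walk j ≡ x)
    all (inj₂ zero)       = 1 , ℕ.<-≤-trans (s≤s (s≤s z≤n)) 2+n≤ , refl
    all (inj₂ (suc zero)) = 3 , ℕ.<-≤-trans (s≤s (s≤s (ℕ.<-trans (s≤s (s≤s z≤n)) 2<n))) 2+n≤ , refl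
    all (inj₁ x) with old (pos x) (pos< x)
    ... | l , l< , e = l , ℕ.<-≤-trans l< 2+n≤ , trans e (cong inj₁ (at-pos x))

-- Arithmetic of branch costs.

Σ[_] : {V : Set} → List V → (V → ℕ) → ℕ
Σ[ xs ] f = sum (map f xs)

module _ {V : Set} where

  Σ-mono-≤ : ∀ (xs : List V) {f h : V → ℕ} → (∀ {x} → x ∈ xs → f x ≤ h x) → Σ[ xs ] f ≤ Σ[ xs ] h
  Σ-mono-≤ []       le = z≤n
  Σ-mono-≤ (x ∷ xs) le = ℕ.+-mono-≤ (le (here refl)) (Σ-mono-≤ xs (le ∘ there))

  Σ-mono-< : ∀ (xs : List V) {f h : V → ℕ} {b} → (∀ {x} → x ∈ xs → f x ≤ h x) →
             b ∈ xs → f b < h b → Σ[ xs ] f < Σ[ xs ] h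
  Σ-mono-< (x ∷ xs) le (here refl) lt = ℕ.+-mono-<-≤ lt (Σ-mono-≤ xs (le ∘ there))
  Σ-mono-< (x ∷ xs) le (there b∈) lt  = ℕ.+-mono-≤-< (le (here refl)) (Σ-mono-< xs (le ∘ there) b∈ lt)

  module _ (_≟_ : DecidableEquality V) where

    Σ-mono-<₂ : ∀ (xs : List V) {f h : V → ℕ} {b c} → (∀ {x} → x ∈ xs → f x ≤ h x) →
                b ∈ xs → c ∈ xs → b ≢ c → f b < h b → f c < h c → 2 + Σ[ xs ] f ≤ Σ[ xs ] h
    Σ-mono-<₂ xs {f} {h} {b} {c} le b∈ c∈ b≢c ltb ltc =
      ℕ.≤-trans (s≤s (Σ-mono-< xs f≤m b∈ ltm)) (Σ-mono-< xs m≤h c∈ mtc)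
      where
      -- `m` agrees with `h` at `b` and with `f` elsewhere, so the strict increases at `b` and at
      -- `c` fall into separate comparisons.
      m : V → ℕ
      m x with x ≟ b
      ... | yes _ = h x
      ... | no _  = f x
      f≤m : ∀ {x} → x ∈ xs → f x ≤ m x
      f≤m {x} x∈ with x ≟ b
      ... | yes _ = le x∈
      ... | no _  = ℕ.≤-refl
      m≤h : ∀ {x} → x ∈ xs → m x ≤ h x
      m≤h {x} x∈ with x ≟ b
      ... | yes _ = ℕ.≤-refl
      ... | no _  = le x∈
      ltm : f b < m b
      ltm with b ≟ b
      ... | yes _ = ltb
      ... | no ne = contradiction refl ne
      mtc : m c < h c
      mtc with c ≟ b
      ... | yes e = contradiction (sym e) b≢c
      ... | no _  = ltc

    -- The case analysis freed of graphs: `g` stands for the domination number and `h` counts the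
    -- chosen vertices in each branch. The alternatives of `single` are, in order: only the centre
    -- is chosen, neither centre nor subdivision vertex, only the subdivision vertex, both.
    module _ (N : List V) (ex dom inn : V → ℕ) (g : ℕ)
      (ex≤dom  : ∀ {b} → b ∈ N → ex b ≤ dom b)
      (dom≤inn : ∀ {b} → b ∈ N → dom b ≤ inn b)
      (upper₁  : g ≤ 1 + Σ[ N ] ex)
      (upper₂  : ∀ {a} → a ∈ N → inn a ≤ dom a → g ≤ Σ[ N ] dom)
      (lower   : 1 + Σ[ N ] ex ≤ g ⊎
                 ∃₂ λ h a → a ∈ N × (∀ {x} → x ∈ N → dom x ≤ h x) × inn a ≤ h a × Σ[ N ] h ≤ g)
      (single  : ∀ {b} → b ∈ N →
                 (∃[ h ] ((∀ {x} → x ∈ N → ex x ≤ h x) × dom b ≤ h b × 1 + Σ[ N ] h ≤ g)) ⊎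
                 (∃[ h ] ((∀ {x} → x ∈ N → dom x ≤ h x) × inn b ≤ h b × Σ[ N ] h ≤ g)) ⊎
                 (∃[ h ] ((∀ {x} → x ∈ N → x ≢ b → dom x ≤ h x) × ex b ≤ h b × 1 + Σ[ N ] h ≤ g)) ⊎
                 2 + Σ[ N ] ex ≤ g)
      (pair₁   : ∀ {b c} → b ∈ N → c ∈ N → b ≢ c → dom b ≤ ex b → dom c ≤ ex c → ¬ 1 + Σ[ N ] ex ≤ g)
      (pair₂   : ∀ {a b c} → a ∈ N → b ∈ N → c ∈ N → a ≢ b → a ≢ c → b ≢ c →
                 inn a ≤ dom a → inn b ≤ dom b → inn c ≤ dom c → ¬ Σ[ N ] dom ≤ g)
      where

      -- The branch saves a vertex once its root is dominated from outside.
      Excusable : V → Set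
      Excusable x = ex x < dom x

      -- With the edge to `b` subdivided, every alternative costs at least `2 + Σ[ N ] ex`: `b` pays
      -- `dom`, or both do, or `c` does on top of the subdivision vertex, or centre and subdivision
      -- vertex are both paid for.
      oneExcusable : ∀ {b c} → b ∈ N → c ∈ N → b ≢ c → Excusable b → ¬ Excusable c
      oneExcusable {b} {c} b∈ c∈ b≢c exb exc with single b∈
      ... | inj₁ (h , ex≤h , dom≤h , le) = ℕ.<⇒≱
              (s≤s (Σ-mono-< N ex≤h b∈ (ℕ.<-≤-trans exb dom≤h))) (ℕ.≤-trans le upper₁)
      ... | inj₂ (inj₁ (h , dom≤h , _ , le)) = ℕ.<⇒≱
              (Σ-mono-<₂ N ex≤dom b∈ c∈ b≢c exb exc)
              (ℕ.≤-trans (Σ-mono-≤ N dom≤h) (ℕ.≤-trans le upper₁))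
      ... | inj₂ (inj₂ (inj₁ (h , dom≤h , exb≤h , le))) = ℕ.<⇒≱
              (s≤s (Σ-mono-< N ex≤h c∈ (ℕ.<-≤-trans exc (dom≤h c∈ (b≢c ∘ sym)))))
              (ℕ.≤-trans le upper₁)
        where
        ex≤h : ∀ {x} → x ∈ N → ex x ≤ h x
        ex≤h {x} x∈ with x ≟ b
        ... | yes refl = exb≤h
        ... | no x≢b   = ℕ.≤-trans (ex≤dom x∈) (dom≤h x∈ x≢b)
      ... | inj₂ (inj₂ (inj₂ le)) = ℕ.<⇒≱ ℕ.≤-refl (ℕ.≤-trans le upper₁)

      module OneExcusable {b} (b∈ : b ∈ N) (exb : Excusable b) where

        tight : ∀ {c} → c ∈ N → c ≢ b → dom c ≤ ex c
        tight c∈ c≢b = ℕ.≮⇒≥ (oneExcusable b∈ c∈ (c≢b ∘ sym) exb)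

        -- Without the centre the cost is at least `Σ[ N ] dom`, which exceeds `Σ[ N ] ex` because
        -- of `b`.
        large : 1 + Σ[ N ] ex ≤ g
        large = Sum.[ (λ le → le) ,
          (λ (h , _ , _ , dom≤h , _ , le) →
            ℕ.≤-trans (Σ-mono-< N ex≤dom b∈ exb) (ℕ.≤-trans (Σ-mono-≤ N dom≤h) le)) ] lower

      -- Among three branches, two differ from the excusable one; both are tight, and `pair₁`
      -- applies to them.
      noExcusable : ∀ {a b c} → a ∈ N → b ∈ N → c ∈ N → a ≢ b → a ≢ c → b ≢ c →
                    ∀ {x} → x ∈ N → ¬ Excusable x
      noExcusable {a} {b} {c} a∈ b∈ c∈ a≢b a≢c b≢c {x} x∈ exx with a ≟ x | b ≟ x
      ... | yes refl | _        = pair₁ b∈ c∈ b≢c (tight b∈ (a≢b ∘ sym)) (tight c∈ (a≢c ∘ sym)) large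
        where open OneExcusable x∈ exx
      ... | no a≢x   | yes refl = pair₁ a∈ c∈ a≢c (tight a∈ a≢x) (tight c∈ (b≢c ∘ sym)) large
        where open OneExcusable x∈ exx
      ... | no a≢x   | no b≢x   = pair₁ a∈ b∈ a≢b (tight a∈ a≢x) (tight b∈ b≢x) large
        where open OneExcusable x∈ exx

      noThreeBranches : ∀ {a b c} → a ∈ N → b ∈ N → c ∈ N → a ≢ b → a ≢ c → b ≢ c → ⊥
      noThreeBranches {a} {b} {c} a∈ b∈ c∈ a≢b a≢c b≢c
        with Any.any? (λ x → inn x ≤? dom x) N | Any.any? (λ x → dom x <? inn x) N
      -- Every `inn` exceeds `dom`, so a set without the centre again costs more than `Σ[ N ] ex`.
      ... | no ¬free | _ = pair₁ a∈ b∈ a≢b (dom≤ex a∈) (dom≤ex b∈) large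
        where
        dom≤ex : ∀ {x} → x ∈ N → dom x ≤ ex x
        dom≤ex x∈ = ℕ.≮⇒≥ (noExcusable a∈ b∈ c∈ a≢b a≢c b≢c x∈)
        large : 1 + Σ[ N ] ex ≤ g
        large = Sum.[ (λ le → le) ,
          (λ (h , x , x∈ , dom≤h , inn≤h , le) → ℕ.≤-trans
            (ℕ.≤-<-trans (Σ-mono-≤ N ex≤dom)
              (Σ-mono-< N dom≤h x∈ (ℕ.<-≤-trans (ℕ.≰⇒> (¬free ∘ lose x∈)) inn≤h))) le) ] lower
      ... | yes _ | no ¬costly = pair₂ a∈ b∈ c∈ a≢b a≢c b≢c (free a∈) (free b∈) (free c∈) large
        where
        free : ∀ {x} → x ∈ N → inn x ≤ dom x
        free x∈ = ℕ.≮⇒≥ (¬costly ∘ lose x∈)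
        large : Σ[ N ] dom ≤ g
        large = Sum.[
          ℕ.≤-trans (ℕ.≤-trans (Σ-mono-≤ N (ℕ.≮⇒≥ ∘ noExcusable a∈ b∈ c∈ a≢b a≢c b≢c)) (ℕ.n≤1+n _)) ,
          (λ (_ , _ , _ , dom≤h , _ , le) → ℕ.≤-trans (Σ-mono-≤ N dom≤h) le) ] lower
      -- The free branch gives `g ≤ Σ[ N ] dom`. Subdividing the edge to the costly branch `y`
      -- exceeds this in each alternative, as `ex` and `dom` have equal sums.
      ... | yes free | yes costly with find free | find costly
      ...   | x , x∈ , x-free | y , y∈ , y-costly = impossible (single y∈)
        where
        small : g ≤ Σ[ N ] dom
        small = upper₂ x∈ x-free
        dom≤ex : Σ[ N ] dom ≤ Σ[ N ] ex
        dom≤ex = Σ-mono-≤ N (ℕ.≮⇒≥ ∘ noExcusable a∈ b∈ c∈ a≢b a≢c b≢c)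
        tooLarge : ¬ 1 + Σ[ N ] dom ≤ g
        tooLarge le = ℕ.<⇒≱ le small
        impossible : _ → ⊥
        impossible (inj₁ (h , ex≤h , _ , le)) =
          tooLarge (ℕ.≤-trans (s≤s (ℕ.≤-trans dom≤ex (Σ-mono-≤ N ex≤h))) le)
        impossible (inj₂ (inj₁ (h , dom≤h , inn≤h , le))) =
          tooLarge (ℕ.≤-trans (Σ-mono-< N dom≤h y∈ (ℕ.<-≤-trans y-costly inn≤h)) le)
        impossible (inj₂ (inj₂ (inj₁ (h , dom≤h , exy≤h , le)))) =
          tooLarge (ℕ.≤-trans (s≤s (ℕ.≤-trans dom≤ex (Σ-mono-≤ N ex≤h))) le)
          where
          ex≤h : ∀ {x} → x ∈ N → ex x ≤ h x
          ex≤h {x} x∈ with x ≟ y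
          ... | yes refl = exy≤h
          ... | no x≢y   = ℕ.≤-trans (ex≤dom x∈) (dom≤h x∈ x≢y)
        impossible (inj₂ (inj₂ (inj₂ le))) =
          tooLarge (ℕ.≤-trans (s≤s (ℕ.≤-trans dom≤ex (ℕ.n≤1+n _))) le)

-- Counting by fibres, and shortest lists.

length-concatMap≤ : ∀ {V W : Set} (f : V → List W) (h : V → ℕ) → (∀ x → length (f x) ≤ h x) →
                    ∀ xs → length (concatMap f xs) ≤ Σ[ xs ] h
length-concatMap≤ f h le []       = z≤n
length-concatMap≤ f h le (x ∷ xs) = ℕ.≤-trans (ℕ.≤-reflexive (List.length-++ (f x)))
  (ℕ.+-mono-≤ (le x) (length-concatMap≤ f h le xs))

module _ {A B : Set} where

  lefts : List (A ⊎ B) → List A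
  lefts []            = []
  lefts (inj₁ a ∷ zs) = a ∷ lefts zs
  lefts (inj₂ b ∷ zs) = lefts zs

  ∈-lefts : ∀ {a zs} → inj₁ a ∈ zs → a ∈ lefts zs
  ∈-lefts {zs = inj₁ _ ∷ _} (here refl) = here refl
  ∈-lefts {zs = inj₁ _ ∷ _} (there a∈)  = there (∈-lefts a∈)
  ∈-lefts {zs = inj₂ _ ∷ _} (there a∈)  = ∈-lefts a∈

  length-lefts≤ : ∀ zs → length (lefts zs) ≤ length zs
  length-lefts≤ []            = z≤n
  length-lefts≤ (inj₁ _ ∷ zs) = s≤s (length-lefts≤ zs)
  length-lefts≤ (inj₂ _ ∷ zs) = ℕ.m≤n⇒m≤1+n (length-lefts≤ zs)

  length-lefts< : ∀ {b zs} → inj₂ b ∈ zs → length (lefts zs) < length zs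
  length-lefts< {zs = inj₁ _ ∷ _}  (there b∈) = s≤s (length-lefts< b∈)
  length-lefts< {zs = inj₂ _ ∷ zs} _          = s≤s (length-lefts≤ zs)

module _ {V : Set} (_≟_ : DecidableEquality V) (comp : V → V) where

  fibre : V → List V → List V
  fibre b = filter (λ x → comp x ≟ b)

  fibre-≢ : ∀ {b x} xs → comp x ≢ b → length (fibre b (x ∷ xs)) ≡ length (fibre b xs)
  fibre-≢ {b} {x} xs ne with comp x ≟ b
  ... | yes e = contradiction e ne
  ... | no _  = refl

  -- `x` enters only the fibre over `comp x`, a value that `bs` lists at most once.
  Σ-fibres-∷ : ∀ {bs} → Unique bs → ∀ x xs →
    Σ[ bs ] (λ b → length (fibre b (x ∷ xs))) ≤ 1 + Σ[ bs ] (λ b → length (fibre b xs))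
  Σ-fibres-∷ [] x xs = z≤n
  Σ-fibres-∷ {b ∷ bs} (b∉ ∷ u) x xs with comp x ≟ b
  ... | no _   = ℕ.≤-trans (ℕ.+-monoʳ-≤ (length (fibre b xs)) (Σ-fibres-∷ u x xs)) (ℕ.≤-reflexive (ℕ.+-suc _ _))
  ... | yes refl = s≤s (ℕ.+-monoʳ-≤ (length (fibre b xs))
    (Σ-mono-≤ bs λ c∈ → ℕ.≤-reflexive (fibre-≢ xs (All.lookup b∉ c∈))))

  Σ-fibres≤ : ∀ {bs} → Unique bs → ∀ xs → Σ[ bs ] (λ b → length (fibre b xs)) ≤ length xs
  Σ-fibres≤ {bs} u []       = ℕ.≤-reflexive (zeros bs)
    where
    zeros : ∀ bs → Σ[ bs ] (λ _ → 0) ≡ 0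
    zeros []       = refl
    zeros (b ∷ bs) = zeros bs
  Σ-fibres≤ u (x ∷ xs) = ℕ.≤-trans (Σ-fibres-∷ u x xs) (s≤s (Σ-fibres≤ u xs))

-- Minimising over subsets keeps the search finite. By monotonicity any list may be traded for the
-- elements of its underlying set, which are no more numerous.
shortest : ∀ {n} {P : List (Fin n) → Set} → U.Decidable P →
  (∀ {xs ys} → (∀ {x} → x ∈ xs → x ∈ ys) → P xs → P ys) → P (allFin n) →
  ∃[ xs ] (P xs × ∀ ys → P ys → length xs ≤ length ys)
shortest {n} {P} P? mono all with least (λ k → anySubset? λ D → P? (elements D) ×-dec (∣ D ∣ ℕ.≟ k))
                     _ (fromList (allFin n) , mono (∈-elements ∘ ∈-fromList) all , refl)
... | _ , (D , pD , refl) , min = elements D , pD , λ ys py →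
  ℕ.≤-trans (ℕ.≤-reflexive (length-elements D))
    (ℕ.≤-trans (min _ (fromList ys , mono (∈-elements ∘ ∈-fromList) py , refl)) (∣fromList∣≤length ys))

-- Branches of the tree at a vertex and their costs.

module _ {n : ℕ} (T : Graph n) (connected : Connected T) (acyclic : ¬ Cycle T)
  (single : ∀ (F : EdgeSet T 1) → γ (subdivide T F) ≤ γ T)
  (pair   : ∀ (F : EdgeSet T 2) → γ (subdivide T F) > γ T) where

  module Branches {v : Fin n} (C : Components T acyclic v) where
    open Components C

    N : List (Fin n)
    N = filter (adj? T v) (allFin n)

    ∈N⁺ : ∀ {b} → Adj T v b → b ∈ N
    ∈N⁺ vb = ∈-filter⁺ (adj? T v) (∈-allFin _) vb

    ∈N⁻ : ∀ {b} → b ∈ N → Adj T v b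
    ∈N⁻ b∈ = proj₂ (∈-filter⁻ (adj? T v) {xs = allFin n} b∈)

    -- `v` is listed too because `comp v ≡ v`: a chosen centre forms a fibre of its own and adds one
    -- to the count.
    unique-v∷N : Unique (v ∷ N)
    unique-v∷N = All.tabulate (λ b∈ e → irrefl T e (∈N⁻ b∈)) ∷ Unique.filter⁺ (adj? T v) (Unique.allFin⁺ n)

    v≢nbr : ∀ {b} → Adj T v b → b ≢ v
    v≢nbr vb refl = irrefl T refl vb

    in-branch : ∀ {b x} → Adj T v b → comp x ≡ b → x ≢ v
    in-branch vb e refl = v≢nbr vb (trans (sym e) comp-v)

    -- The dominator must lie in the branch while `E` may have entries elsewhere; this makes the
    -- requirements monotone in `E`, as `shortest` asks.
    CoveredWithin : Fin n → List (Fin n) → Fin n → Set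
    CoveredWithin b E x = ∃[ u ] (u ∈ E × comp u ≡ b × (x ≡ u ⊎ Adj T x u))

    CoversBranch CoversInterior CoversWithRoot : Fin n → List (Fin n) → Set
    CoversBranch   b E = ∀ x → comp x ≡ b → CoveredWithin b E x
    CoversInterior b E = ∀ x → comp x ≡ b → x ≢ b → CoveredWithin b E x
    CoversWithRoot b E = CoversBranch b E × b ∈ E

    coveredWithin? : ∀ b E → U.Decidable (CoveredWithin b E)
    coveredWithin? b E x = Fin.any? λ u →
      member? Fin._≟_ u E ×-dec (comp u Fin.≟ b) ×-dec ((x Fin.≟ u) ⊎-dec adj? T x u)

    coversBranch? : ∀ b → U.Decidable (CoversBranch b)
    coversBranch? b E = Fin.all? λ x → (comp x Fin.≟ b) →-dec coveredWithin? b E x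

    coversInterior? : ∀ b → U.Decidable (CoversInterior b)
    coversInterior? b E = Fin.all? λ x → (comp x Fin.≟ b) →-dec ¬? (x Fin.≟ b) →-dec coveredWithin? b E x

    coversWithRoot? : ∀ b → U.Decidable (CoversWithRoot b)
    coversWithRoot? b E = coversBranch? b E ×-dec member? Fin._≟_ b E

    enlarge : ∀ {b x xs ys} → (∀ {y} → y ∈ xs → y ∈ ys) → CoveredWithin b xs x → CoveredWithin b ys x
    enlarge sub (u , u∈ , rest) = u , sub u∈ , rest

    allCoversBranch : ∀ b → CoversBranch b (allFin n)
    allCoversBranch b x e = x , ∈-allFin x , e , inj₁ refl

    optInterior : ∀ b → ∃[ xs ] (CoversInterior b xs × ∀ ys → CoversInterior b ys → length xs ≤ length ys)
    optInterior b = shortest (coversInterior? b) (λ sub p x e ne → enlarge sub (p x e ne))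
      (λ x e _ → allCoversBranch b x e)

    optBranch : ∀ b → ∃[ xs ] (CoversBranch b xs × ∀ ys → CoversBranch b ys → length xs ≤ length ys)
    optBranch b = shortest (coversBranch? b) (λ sub p x e → enlarge sub (p x e)) (allCoversBranch b)

    optRoot : ∀ b → ∃[ xs ] (CoversWithRoot b xs × ∀ ys → CoversWithRoot b ys → length xs ≤ length ys)
    optRoot b = shortest (coversWithRoot? b) (λ sub (p , b∈) → (λ x e → enlarge sub (p x e)) , sub b∈)
      (allCoversBranch b , ∈-allFin b)

    ex dom inn : Fin n → ℕ
    ex  b = length (proj₁ (optInterior b))
    dom b = length (proj₁ (optBranch b))
    inn b = length (proj₁ (optRoot b))

    ex≤ : ∀ {b ys} → CoversInterior b ys → ex b ≤ length ys
    ex≤ {b} p = proj₂ (proj₂ (optInterior b)) _ p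

    dom≤ : ∀ {b ys} → CoversBranch b ys → dom b ≤ length ys
    dom≤ {b} p = proj₂ (proj₂ (optBranch b)) _ p

    inn≤ : ∀ {b ys} → CoversWithRoot b ys → inn b ≤ length ys
    inn≤ {b} p = proj₂ (proj₂ (optRoot b)) _ p

    ex≤dom : ∀ b → ex b ≤ dom b
    ex≤dom b = ex≤ λ x e _ → proj₁ (proj₂ (optBranch b)) x e

    dom≤inn : ∀ b → dom b ≤ inn b
    dom≤inn b = dom≤ (proj₁ (proj₁ (proj₂ (optRoot b))))

    -- Among optimal choices, prefer the ones satisfying the stronger requirement.
    chooseInterior : ∀ b → ∃[ xs ] (length xs ≤ ex b × CoversInterior b xs × (dom b ≤ ex b → CoversBranch b xs))
    chooseInterior b with dom b ≤? ex b
    ... | yes le = proj₁ (optBranch b) , le , (λ x e _ → proj₁ (proj₂ (optBranch b)) x e) ,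
                   λ _ → proj₁ (proj₂ (optBranch b))
    ... | no ¬le = proj₁ (optInterior b) , ℕ.≤-refl , proj₁ (proj₂ (optInterior b)) ,
                   λ le → contradiction le ¬le

    chooseBranch : ∀ b → ∃[ xs ] (length xs ≤ dom b × CoversBranch b xs × (inn b ≤ dom b → b ∈ xs))
    chooseBranch b with inn b ≤? dom b
    ... | yes le = proj₁ (optRoot b) , le , proj₁ (proj₁ (proj₂ (optRoot b))) ,
                   λ _ → proj₂ (proj₁ (proj₂ (optRoot b)))
    ... | no ¬le = proj₁ (optBranch b) , ℕ.≤-refl , proj₁ (proj₂ (optBranch b)) ,
                   λ le → contradiction le ¬le

    ∈-concat : ∀ (f : Fin n → List (Fin n)) {b u} → b ∈ N → u ∈ f b → u ∈ concatMap f N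
    ∈-concat f b∈ u∈ = ∈-concatMap⁺ f (Any.map (λ { refl → u∈ }) b∈)

    -- Assembled from the preferred optimal choices, so that they still dominate after the
    -- subdivisions in `pair₁` and `pair₂`.
    withCentre withoutCentre : List (Fin n)
    withCentre    = v ∷ concatMap (proj₁ ∘ chooseInterior) N
    withoutCentre = concatMap (proj₁ ∘ chooseBranch) N

    length-withCentre : length withCentre ≤ 1 + Σ[ N ] ex
    length-withCentre = s≤s (length-concatMap≤ _ ex (λ b → proj₁ (proj₂ (chooseInterior b))) N)

    length-withoutCentre : length withoutCentre ≤ Σ[ N ] dom
    length-withoutCentre = length-concatMap≤ _ dom (λ b → proj₁ (proj₂ (chooseBranch b))) N

    withCentre-inner : ∀ {x} → x ≢ v → x ≢ comp x ⊎ dom (comp x) ≤ ex (comp x) →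
                       CoveredWithin (comp x) withCentre x
    withCentre-inner {x} x≢v (inj₁ ne) =
      enlarge (there ∘ ∈-concat _ (∈N⁺ (comp-nbr x≢v)))
        (proj₁ (proj₂ (proj₂ (chooseInterior (comp x)))) x refl ne)
    withCentre-inner {x} x≢v (inj₂ le) =
      enlarge (there ∘ ∈-concat _ (∈N⁺ (comp-nbr x≢v)))
        (proj₂ (proj₂ (proj₂ (chooseInterior (comp x)))) le x refl)

    withoutCentre-inner : ∀ {x} → x ≢ v → CoveredWithin (comp x) withoutCentre x
    withoutCentre-inner {x} x≢v =
      enlarge (∈-concat _ (∈N⁺ (comp-nbr x≢v))) (proj₁ (proj₂ (proj₂ (chooseBranch (comp x)))) x refl)

    root∈withoutCentre : ∀ {b} → b ∈ N → inn b ≤ dom b → b ∈ withoutCentre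
    root∈withoutCentre {b} b∈ le = ∈-concat _ b∈ (proj₂ (proj₂ (proj₂ (chooseBranch b))) le)

    upper₁ : γ T ≤ 1 + Σ[ N ] ex
    upper₁ = ℕ.≤-trans (γ≤length T cov) length-withCentre
      where
      cov : Covers (Adj T) withCentre
      cov x with x Fin.≟ v
      ... | yes e = v , here refl , inj₁ e
      ... | no x≢v with x Fin.≟ comp x
      ...   | yes e = v , here refl , inj₂ (adjSym T (subst (Adj T v) (sym e) (comp-nbr x≢v)))
      ...   | no ne with withCentre-inner x≢v (inj₁ ne)
      ...     | u , u∈ , _ , c = u , u∈ , c

    upper₂ : ∀ {a} → a ∈ N → inn a ≤ dom a → γ T ≤ Σ[ N ] dom
    upper₂ {a} a∈ le = ℕ.≤-trans (γ≤length T cov) length-withoutCentre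
      where
      cov : Covers (Adj T) withoutCentre
      cov x with x Fin.≟ v
      ... | yes refl = a , root∈withoutCentre a∈ le , inj₂ (∈N⁻ a∈)
      ... | no x≢v with withoutCentre-inner x≢v
      ...   | u , u∈ , _ , c = u , u∈ , c

    module TwoEdges {b c} (vb : Adj T v b) (vc : Adj T v c) (b≢c : b ≢ c) where
      F : EdgeSet T 2
      F = proj₁ (twoEdges T vb vc b≢c)
      open EdgeSet F

      joins₀ : Joins (edge zero) v b
      joins₀ = proj₁ (proj₂ (twoEdges T vb vc b≢c))
      joins₁ : Joins (edge (suc zero)) v c
      joins₁ = proj₂ (proj₂ (twoEdges T vb vc b≢c))

      contains⇒ : ∀ {x y} → Contains x y → (x ≡ v × (y ≡ b ⊎ y ≡ c)) ⊎ (y ≡ v × (x ≡ b ⊎ x ≡ c))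
      contains⇒ (zero , j)     = Sum.map (map₂ inj₁) (map₂ inj₁) (joins-match joins₀ j)
      contains⇒ (suc zero , j) = Sum.map (map₂ inj₂) (map₂ inj₂) (joins-match joins₁ j)

      -- Both subdivided edges end in `v`, whereas domination inside a branch uses edges off `v`.
      within : ∀ {x E} → x ≢ v → CoveredWithin (comp x) E x →
               ∃[ u ] (u ∈ E × (x ≡ u ⊎ (Adj T x u × ¬ Contains x u)))
      within x≢v (u , u∈ , e , inj₁ x≡u) = u , u∈ , inj₁ x≡u
      within {x} x≢v (u , u∈ , e , inj₂ xu) = u , u∈ , inj₂ (xu , elsewhere ∘ contains⇒)
        where
        elsewhere : ¬ ((x ≡ v × (u ≡ b ⊎ u ≡ c)) ⊎ (u ≡ v × (x ≡ b ⊎ x ≡ c)))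
        elsewhere (inj₁ (x≡v , _)) = x≢v x≡v
        elsewhere (inj₂ (u≡v , _)) = in-branch (comp-nbr x≢v) e u≡v

      touched : ∀ {E} → (v ∈ E ⊎ (b ∈ E × c ∈ E)) → ∀ k → ∃[ u ] (u ∈ E × EndpointOf u k)
      touched (inj₁ v∈)       zero       = v , v∈ , joins-start joins₀
      touched (inj₁ v∈)       (suc zero) = v , v∈ , joins-start joins₁
      touched (inj₂ (b∈ , _)) zero       = b , b∈ , joins-start (swap joins₀)
      touched (inj₂ (_ , c∈)) (suc zero) = c , c∈ , joins-start (swap joins₁)

    -- The centre dominates both new vertices, and the cut-off roots `b` and `c` are dominated
    -- inside their tight branches.
    pair₁ : ∀ {b c} → b ∈ N → c ∈ N → b ≢ c → dom b ≤ ex b → dom c ≤ ex c → ¬ 1 + Σ[ N ] ex ≤ γ T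
    pair₁ {b} {c} b∈ c∈ b≢c leb lec le = ℕ.<⇒≱ (pair F)
      (ℕ.≤-trans (subdivide-γ≤ T F cov (touched (inj₁ (here refl)))) (ℕ.≤-trans length-withCentre le))
      where
      open TwoEdges (∈N⁻ b∈) (∈N⁻ c∈) b≢c
      open EdgeSet F using (Contains)
      cov : Covers (λ x u → Adj T x u × ¬ Contains x u) withCentre
      cov x with x Fin.≟ v
      ... | yes e = v , here refl , inj₁ e
      ... | no x≢v with x Fin.≟ comp x
      ...   | no ne = within x≢v (withCentre-inner x≢v (inj₁ ne))
      ...   | yes e with dom (comp x) ≤? ex (comp x)
      ...     | yes le′ = within x≢v (withCentre-inner x≢v (inj₂ le′))
      -- The branch of this root is not tight, so the root is neither `b` nor `c` and keeps its edge
      -- to `v`.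
      ...     | no ¬le = v , here refl ,
        inj₂ (adjSym T (subst (Adj T v) (sym e) (comp-nbr x≢v)) , excluded ∘ contains⇒)
        where
        ≢tight : ∀ {y} → dom y ≤ ex y → x ≢ y
        ≢tight le′ refl = ¬le (subst (λ z → dom z ≤ ex z) e le′)
        excluded : ¬ ((x ≡ v × (v ≡ b ⊎ v ≡ c)) ⊎ (v ≡ v × (x ≡ b ⊎ x ≡ c)))
        excluded (inj₁ (x≡v , _))      = x≢v x≡v
        excluded (inj₂ (_ , inj₁ x≡b)) = ≢tight leb x≡b
        excluded (inj₂ (_ , inj₂ x≡c)) = ≢tight lec x≡c

    -- The chosen roots `b` and `c` dominate the new vertices, while `v` stays dominated by `a`
    -- along an edge that is kept.
    pair₂ : ∀ {a b c} → a ∈ N → b ∈ N → c ∈ N → a ≢ b → a ≢ c → b ≢ c →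
            inn a ≤ dom a → inn b ≤ dom b → inn c ≤ dom c → ¬ Σ[ N ] dom ≤ γ T
    pair₂ {a} {b} {c} a∈ b∈ c∈ a≢b a≢c b≢c lea leb lec le = ℕ.<⇒≱ (pair F)
      (ℕ.≤-trans (subdivide-γ≤ T F cov
        (touched (inj₂ (root∈withoutCentre b∈ leb , root∈withoutCentre c∈ lec))))
        (ℕ.≤-trans length-withoutCentre le))
      where
      open TwoEdges (∈N⁻ b∈) (∈N⁻ c∈) b≢c
      open EdgeSet F using (Contains)
      excluded : ¬ ((v ≡ v × (a ≡ b ⊎ a ≡ c)) ⊎ (a ≡ v × (v ≡ b ⊎ v ≡ c)))
      excluded (inj₁ (_ , inj₁ a≡b)) = a≢b a≡b
      excluded (inj₁ (_ , inj₂ a≡c)) = a≢c a≡c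
      excluded (inj₂ (a≡v , _))      = v≢nbr (∈N⁻ a∈) a≡v
      cov : Covers (λ x u → Adj T x u × ¬ Contains x u) withoutCentre
      cov x with x Fin.≟ v
      ... | yes refl = a , root∈withoutCentre a∈ lea , inj₂ (∈N⁻ a∈ , excluded ∘ contains⇒)
      ... | no x≢v   = within x≢v (withoutCentre-inner x≢v)

    part : List (Fin n) → Fin n → List (Fin n)
    part D b = fibre Fin._≟_ comp b D

    size : List (Fin n) → Fin n → ℕ
    size D b = length (part D b)

    ∈-part : ∀ {D b u} → u ∈ D → comp u ≡ b → u ∈ part D b
    ∈-part u∈ e = ∈-filter⁺ (λ x → comp x Fin.≟ _) u∈ e

    Σ-size≤ : ∀ D → Σ[ N ] (size D) ≤ length D
    Σ-size≤ D with unique-v∷N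
    ... | _ ∷ u = Σ-fibres≤ Fin._≟_ comp u D

    Σ-size< : ∀ {D} → v ∈ D → 1 + Σ[ N ] (size D) ≤ length D
    Σ-size< {D} v∈ = ℕ.≤-trans (ℕ.+-monoˡ-≤ _ (nonempty (∈-part v∈ comp-v)))
      (Σ-fibres≤ Fin._≟_ comp unique-v∷N D)
      where
      nonempty : ∀ {xs : List (Fin n)} {x} → x ∈ xs → 1 ≤ length xs
      nonempty (here _)  = s≤s z≤n
      nonempty (there _) = s≤s z≤n

    -- Adjacent vertices other than `v` share a branch, so a dominator different from `v` survives
    -- the restriction.
    restrict : ∀ {D b x u} → Adj T v b → comp x ≡ b → u ∈ D → x ≡ u ⊎ Adj T x u → u ≢ v →
               CoveredWithin b (part D b) x
    restrict vb e u∈ (inj₁ refl) u≢v = _ , ∈-part u∈ e , e , inj₁ refl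
    restrict vb e u∈ (inj₂ xu) u≢v = _ , ∈-part u∈ e′ , e′ , inj₂ xu
      where e′ = trans (sym (comp-adj (in-branch vb e) u≢v xu)) e

    only-root-adjacent : ∀ {b x u} → Adj T v b → comp x ≡ b → x ≡ u ⊎ Adj T x u → u ≡ v → x ≡ b
    only-root-adjacent vb e (inj₁ x≡u) refl = contradiction x≡u (in-branch vb e)
    only-root-adjacent vb e (inj₂ xv)  refl = trans (sym (comp-fix (adjSym T xv))) e

    -- An optimal set is cut into its parts. If it contains `v`, only roots can rely on `v`; if not,
    -- every part covers its branch, and the vertex dominating `v` is a root in its own part.
    lower : 1 + Σ[ N ] ex ≤ γ T ⊎
            ∃₂ λ h a → a ∈ N × (∀ {x} → x ∈ N → dom x ≤ h x) × inn a ≤ h a × Σ[ N ] h ≤ γ T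
    lower with γ-attained T
    ... | D , cov , eq with member? Fin._≟_ v D
    ...   | yes v∈ = inj₁ (ℕ.≤-trans (s≤s (Σ-mono-≤ N λ b∈ → ex≤ (interior (∈N⁻ b∈))))
                      (ℕ.≤-trans (Σ-size< v∈) (ℕ.≤-reflexive eq)))
      where
      interior : ∀ {b} → Adj T v b → CoversInterior b (part D b)
      interior vb x e ne with cov x
      ... | u , u∈ , c = restrict vb e u∈ c (ne ∘ only-root-adjacent vb e c)
    ...   | no v∉ = inj₂ (size D , centre (cov v))
      where
      branch : ∀ {b} → Adj T v b → CoversBranch b (part D b)
      branch vb x e with cov x
      ... | u , u∈ , c = restrict vb e u∈ c λ { refl → v∉ u∈ }
      centre : ∃[ u ] (u ∈ D × (v ≡ u ⊎ Adj T v u)) →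
               ∃[ a ] (a ∈ N × (∀ {x} → x ∈ N → dom x ≤ size D x) × inn a ≤ size D a × Σ[ N ] (size D) ≤ γ T)
      centre (u , u∈ , inj₁ refl) = contradiction u∈ v∉
      centre (u , u∈ , inj₂ vu) = u , ∈N⁺ vu , (λ b∈ → dom≤ (branch (∈N⁻ b∈))) ,
        inn≤ (branch vu , ∈-part u∈ (comp-fix vu)) ,
        ℕ.≤-trans (Σ-size≤ D) (ℕ.≤-reflexive eq)

    SingleOutcome : Fin n → Set
    SingleOutcome b =
      (∃[ h ] ((∀ {x} → x ∈ N → ex x ≤ h x) × dom b ≤ h b × 1 + Σ[ N ] h ≤ γ T)) ⊎
      (∃[ h ] ((∀ {x} → x ∈ N → dom x ≤ h x) × inn b ≤ h b × Σ[ N ] h ≤ γ T)) ⊎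
      (∃[ h ] ((∀ {x} → x ∈ N → x ≢ b → dom x ≤ h x) × ex b ≤ h b × 1 + Σ[ N ] h ≤ γ T)) ⊎
      2 + Σ[ N ] ex ≤ γ T

    module OneEdge {b} (vb : Adj T v b) where
      F : EdgeSet T 1
      F = proj₁ (singleEdge T vb)
      open EdgeSet F

      contained : Contains b v
      contained = zero , swap (proj₂ (singleEdge T vb))

      endpoint⇒ : ∀ {x} → EndpointOf x zero → x ≡ v ⊎ x ≡ b
      endpoint⇒ = joins-ends (proj₂ (singleEdge T vb))

      ys : List (Fin n ⊎ Fin 1)
      ys = proj₁ (subdivide-γ-attained T F)

      cov : Covers (SubdividedAdj T F) ys
      cov = proj₁ (proj₂ (subdivide-γ-attained T F))

      length-ys≤ : length ys ≤ γ T
      length-ys≤ = ℕ.≤-trans (ℕ.≤-reflexive (proj₂ (proj₂ (subdivide-γ-attained T F)))) (single F)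

      D : List (Fin n)
      D = lefts ys

      Witness : Fin n → Set
      Witness x = ∃[ u ] (u ∈ D × (x ≡ u ⊎ (Adj T x u × ¬ Contains x u)))

      old : ∀ x → Witness x ⊎ (inj₂ zero ∈ ys × (x ≡ v ⊎ x ≡ b))
      old x with cov (inj₁ x)
      ... | inj₁ u , u∈ , inj₁ refl  = inj₁ (u , ∈-lefts u∈ , inj₁ refl)
      ... | inj₁ u , u∈ , inj₂ xu    = inj₁ (u , ∈-lefts u∈ , inj₂ xu)
      ... | inj₂ zero , w∈ , inj₂ e  = inj₂ (w∈ , endpoint⇒ e)

      plain : ∀ {x u} → x ≡ u ⊎ (Adj T x u × ¬ Contains x u) → x ≡ u ⊎ Adj T x u
      plain = Sum.map (λ e → e) proj₁

      not-root : ∀ {c x} → Adj T v c → comp x ≡ c → x ≢ c ⊎ c ≢ b → ¬ (x ≡ v ⊎ x ≡ b)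
      not-root vc e ne (inj₁ x≡v) = in-branch vc e x≡v
      not-root vc e (inj₁ x≢c) (inj₂ refl) = x≢c (trans (sym (comp-fix vb)) e)
      not-root vc e (inj₂ c≢b) (inj₂ refl) = c≢b (trans (sym e) (comp-fix vb))

      -- The new vertex dominates only `v` and the root `b`, and `v` itself dominates only roots.
      interior : ∀ {c} → Adj T v c → CoversInterior c (part D c)
      interior vc x e ne with old x
      ... | inj₁ (u , u∈ , c) = restrict vc e u∈ (plain c) (ne ∘ only-root-adjacent vc e (plain c))
      ... | inj₂ (_ , x≡)     = contradiction x≡ (not-root vc e (inj₁ ne))

      otherBranch : ∀ {c} → v ∉ D → Adj T v c → c ≢ b → CoversBranch c (part D c)
      otherBranch v∉ vc c≢b x e with old x
      ... | inj₁ (u , u∈ , c) = restrict vc e u∈ (plain c) λ { refl → v∉ u∈ }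
      ... | inj₂ (_ , x≡)     = contradiction x≡ (not-root vc e (inj₂ c≢b))

      -- A chosen subdivision vertex costs one beyond `D` and helps only `v` and `b`. If it is not
      -- chosen, `b` cannot rely on `v`, its edge being cut, and the subdivision vertex itself needs
      -- `v` or `b` in `D`.
      outcome : SingleOutcome b
      outcome with Any.any? new? ys | member? Fin._≟_ v D
        where
        new? : ∀ z → Dec (inj₂ zero ≡ z)
        new? (inj₁ _)    = no λ ()
        new? (inj₂ zero) = yes refl
      ... | yes w∈ | yes v∈ = inj₂ (inj₂ (inj₂ (ℕ.≤-trans (s≤s
              (ℕ.≤-trans (s≤s (Σ-mono-≤ N λ c∈ → ex≤ (interior (∈N⁻ c∈)))) (Σ-size< v∈)))
              (ℕ.≤-trans (length-lefts< w∈) length-ys≤))))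
      ... | yes w∈ | no v∉ = inj₂ (inj₂ (inj₁ (size D ,
              (λ c∈ c≢b → dom≤ (otherBranch v∉ (∈N⁻ c∈) c≢b)) , ex≤ (interior vb) ,
              ℕ.≤-trans (s≤s (Σ-size≤ D)) (ℕ.≤-trans (length-lefts< w∈) length-ys≤))))
      ... | no w∉ | yes v∈ = inj₁ (size D , (λ c∈ → ex≤ (interior (∈N⁻ c∈))) , dom≤ ownBranch ,
              ℕ.≤-trans (Σ-size< v∈) (ℕ.≤-trans (length-lefts≤ ys) length-ys≤))
        where
        ownBranch : CoversBranch b (part D b)
        ownBranch x e with old x
        ... | inj₂ (w∈ , _) = contradiction w∈ w∉
        ... | inj₁ (u , u∈ , c) = restrict vb e u∈ (plain c) λ u≡v →
                cut c u≡v (only-root-adjacent vb e (plain c) u≡v)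
          where
          cut : ∀ {x u} → x ≡ u ⊎ (Adj T x u × ¬ Contains x u) → u ≡ v → x ≡ b → ⊥
          cut (inj₁ refl)     refl refl = irrefl T refl vb
          cut (inj₂ (_ , ¬c)) refl refl = ¬c contained
      ... | no w∉ | no v∉ = inj₂ (inj₁ (size D , (λ c∈ → dom≤ (branch (∈N⁻ c∈))) ,
              inn≤ (branch vb , ∈-part (b∈D (cov (inj₂ zero))) (comp-fix vb)) ,
              ℕ.≤-trans (Σ-size≤ D) (ℕ.≤-trans (length-lefts≤ ys) length-ys≤)))
        where
        branch : ∀ {c} → Adj T v c → CoversBranch c (part D c)
        branch vc x e with old x
        ... | inj₁ (u , u∈ , c) = restrict vc e u∈ (plain c) λ { refl → v∉ u∈ }
        ... | inj₂ (w∈ , _)     = contradiction w∈ w∉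
        b∈D : ∃[ z ] (z ∈ ys × (inj₂ zero ≡ z ⊎ SubdividedAdj T F (inj₂ zero) z)) → b ∈ D
        b∈D (inj₂ zero , w∈ , _) = contradiction w∈ w∉
        b∈D (inj₁ u , u∈ , inj₂ e) with endpoint⇒ e
        ... | inj₁ refl = contradiction (∈-lefts u∈) v∉
        ... | inj₂ refl = ∈-lefts u∈

  atMostTwo : AtMostTwoNeighbours T acyclic
  atMostTwo {v} {a} {b} {c} va vb vc with a Fin.≟ b | a Fin.≟ c | b Fin.≟ c
  ... | yes e | _     | _     = inj₁ e
  ... | no _  | yes e | _     = inj₂ (inj₁ e)
  ... | no _  | no _  | yes e = inj₂ (inj₂ e)
  ... | no a≢b | no a≢c | no b≢c =
    ⊥-elim (noThreeBranches Fin._≟_ N ex dom inn (γ T) (λ {b} _ → ex≤dom b) (λ {b} _ → dom≤inn b)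
      upper₁ upper₂ lower (λ b∈ → OneEdge.outcome (∈N⁻ b∈)) pair₁ pair₂
      (∈N⁺ va) (∈N⁺ vb) (∈N⁺ vc) a≢b a≢c b≢c)
    where open Branches (components T acyclic connected v)

-- Orders of paths modulo three.

residue : ∀ n → ∃[ k ] (n ≡ 3 * k ⊎ n ≡ 3 * k + 1 ⊎ n ≡ 3 * k + 2)
residue 0 = 0 , inj₁ refl
residue 1 = 0 , inj₂ (inj₁ refl)
residue 2 = 0 , inj₂ (inj₂ refl)
residue (suc (suc (suc n))) with residue n
... | k , inj₁ refl        = suc k , inj₁ (sym (ℕ.*-suc 3 k))
... | k , inj₂ (inj₁ refl) = suc k , inj₂ (inj₁ (cong (_+ 1) (sym (ℕ.*-suc 3 k))))
... | k , inj₂ (inj₂ refl) = suc k , inj₂ (inj₂ (cong (_+ 2) (sym (ℕ.*-suc 3 k))))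

third-< : ∀ k {l m} → 3 * k < l → l ≤ 3 * m → k < m
third-< k {m = m} lt le = ℕ.*-cancelˡ-< 3 k m (ℕ.<-≤-trans lt le)

3k<3k+1+ : ∀ k r → 3 * k < 3 * k + suc r
3k<3k+1+ k r = ℕ.m<m+n (3 * k) (s≤s z≤n)

3k+3≡ : ∀ k → 3 * k + 3 ≡ 3 * suc k
3k+3≡ k = trans (ℕ.+-comm (3 * k) 3) (sym (ℕ.*-suc 3 k))

module _ {n : ℕ} {G : Graph n} (S : Spine G) where
  open Spine S

  anEdge : 1 < n → EdgeSet G 1
  anEdge 1<n = proj₁ (singleEdge G (adj-step 1<n))

  -- At order `3 * k` one subdivision already raises the domination number above `k`. At order
  -- `3 * k + 1` some two subdivisions give `3 * k + 3` vertices, still dominated by `k + 1`.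
  spine-order≡2 : n ≥ 3 → (∀ (F : EdgeSet G 1) → γ (subdivide G F) ≤ γ G) →
    (∀ (F : EdgeSet G 2) → γ (subdivide G F) > γ G) → ∃[ k ] (k ≥ 1 × n ≡ 3 * k + 2)
  spine-order≡2 n≥3 single pair with residue n
  ... | k , inj₁ e = contradiction (ℕ.≤-trans (ℕ.≤-trans k< (single F)) (spine-γ≤ S k (ℕ.≤-reflexive e))) (ℕ.<⇒≱ ℕ.≤-refl)
    where
    F = anEdge (ℕ.<-trans (ℕ.n<1+n 1) n≥3)
    k< : k < γ (subdivide G F)
    k< = third-< k (subst (λ l → 3 * k < l + 1) (sym e) (3k<3k+1+ k 0))
           (subdivide-order≤3*γ G F (spine-maxDegree2 S))
  ... | k , inj₂ (inj₁ e) with spine-γ₂≤ S (suc k) n≥3 (ℕ.≤-reflexive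
          (trans (cong (2 +_) e) (trans (ℕ.+-comm 2 (3 * k + 1)) (trans (ℕ.+-assoc (3 * k) 1 2) (3k+3≡ k)))))
  ...   | F , le = contradiction (ℕ.≤-trans (pair F) le)
          (ℕ.<⇒≱ (s≤s (third-< k (subst (3 * k <_) (sym e) (3k<3k+1+ k 0)) (order≤3*γ G (spine-maxDegree2 S)))))
  spine-order≡2 n≥3 single pair | zero  , inj₂ (inj₂ refl) = contradiction n≥3 λ { (s≤s (s≤s ())) }
  spine-order≡2 n≥3 single pair | suc k , inj₂ (inj₂ e)    = suc k , s≤s z≤n , e

  module _ (k : ℕ) (e : n ≡ 3 * k + 2) where

    1<n : 1 < n
    1<n = subst (1 <_) (trans (ℕ.+-comm 2 (3 * k)) (sym e)) (s≤s (s≤s z≤n))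

    -- Here and in the next two lemmas: `3 * k + 2` and `3 * k + 3` lie above `3 * k` and within
    -- `3 * suc k`, whereas `3 * k + 4` exceeds `3 * suc k`.
    γ≡ : γ G ≡ suc k
    γ≡ = ℕ.≤-antisym
      (spine-γ≤ S (suc k) (ℕ.≤-trans (ℕ.≤-reflexive e)
        (ℕ.≤-trans (ℕ.+-monoʳ-≤ (3 * k) (ℕ.n≤1+n 2)) (ℕ.≤-reflexive (3k+3≡ k)))))
      (third-< k (subst (3 * k <_) (sym e) (3k<3k+1+ k 1)) (order≤3*γ G (spine-maxDegree2 S)))

    γ₁≡ : ∀ (F : EdgeSet G 1) → γ (subdivide G F) ≡ suc k
    γ₁≡ F = ℕ.≤-antisym
      (spine-γ₁≤ S F (suc k) (ℕ.≤-reflexive (trans (cong suc e)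
        (trans (ℕ.+-comm 1 (3 * k + 2)) (trans (ℕ.+-assoc (3 * k) 2 1) (3k+3≡ k))))))
      (third-< k (subst (λ l → 3 * k < l + 1) (sym e) (ℕ.<-≤-trans (3k<3k+1+ k 1) (ℕ.m≤m+n _ 1)))
        (subdivide-order≤3*γ G F (spine-maxDegree2 S)))

    γ₂> : ∀ (F : EdgeSet G 2) → γ (subdivide G F) > γ G
    γ₂> F = subst (_< γ (subdivide G F)) (sym γ≡)
      (third-< (suc k)
        (subst₂ (λ l l′ → l < l′ + 2) (3k+3≡ k) (sym e)
          (subst (3 * k + 3 <_) (sym (ℕ.+-assoc (3 * k) 2 2)) (ℕ.+-monoʳ-< (3 * k) ℕ.≤-refl)))
        (subdivide-order≤3*γ G F (spine-maxDegree2 S)))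

≅Path⇒spine′ : ∀ {n m} {G : Graph n} → n ≥ 1 → G ≅ Path m → Spine G
≅Path⇒spine′ (s≤s _) G≅P with refl ← ≅⇒order≡ G≅P = ≅Path⇒spine G≅P

theorem4p3 : ∀ {n : ℕ} (T : Graph n) → IsTree T → n ≥ 3 →
    (Critical 2 T × SubdivisionNumber T 2) ⇔ (∃[ k ] (k ≥ 1 × T ≅ Path (3 * k + 2)))
theorem4p3 {n} T (connected , acyclic) n≥3 = mk⇔ forward backward
  where
  n≥1 : n ≥ 1
  n≥1 = ℕ.≤-trans (s≤s z≤n) n≥3

  forward : Critical 2 T × SubdivisionNumber T 2 → ∃[ k ] (k ≥ 1 × T ≅ Path (3 * k + 2))
  forward (critical , _ , min) with ≅Path T acyclic connected two (vertex n≥1)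
    where
    single : ∀ (F : EdgeSet T 1) → γ (subdivide T F) ≤ γ T
    single F = ℕ.≮⇒≥ λ lt → contradiction (min 1 (F , lt)) λ { (s≤s ()) }
    two : AtMostTwoNeighbours T acyclic
    two = atMostTwo T connected acyclic single (Critical.increases critical)
    vertex : ∀ {m} → m ≥ 1 → Fin m
    vertex (s≤s _) = zero
  ... | m , T≅P with spine-order≡2 (≅Path⇒spine′ n≥1 T≅P) n≥3
                       (λ F → ℕ.≮⇒≥ λ lt → contradiction (min 1 (F , lt)) λ { (s≤s ()) })
                       (Critical.increases critical)
  ...   | k , k≥1 , e = k , k≥1 , subst (λ l → T ≅ Path l) (trans (sym (≅⇒order≡ T≅P)) e) T≅P

  backward : ∃[ k ] (k ≥ 1 × T ≅ Path (3 * k + 2)) → Critical 2 T × SubdivisionNumber T 2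
  backward (k , _ , T≅P) = record
    { q≥1       = s≤s z≤n
    ; order≥3   = n≥3
    ; connected = connected
    ; increases = γ₂> S k e
    ; preserved = F₁ , trans (γ₁≡ S k e F₁) (sym (γ≡ S k e))
    } , (F₂ , γ₂> S k e F₂) , λ where
      0 (F , lt)         → contradiction (subdivide-∅ T F) (ℕ.<⇒≱ lt)
      1 (F , lt)         → contradiction (trans (γ≡ S k e) (sym (γ₁≡ S k e F))) (ℕ.<⇒≢ lt)
      (suc (suc _)) _    → s≤s (s≤s z≤n)
    where
    e : n ≡ 3 * k + 2
    e = ≅⇒order≡ T≅P
    S : Spine T
    S = ≅Path⇒spine′ n≥1 T≅P
    F₁ : EdgeSet T 1
    F₁ = anEdge S (1<n S k e)
    F₂ : EdgeSet T 2
    -- A source of two distinct edges; the bound `n` is chosen because `2 + n ≤ 3 * n` is immediate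
    -- from `n ≥ 3`.
    F₂ = proj₁ (spine-γ₂≤ S n n≥3 (ℕ.≤-trans (ℕ.+-monoˡ-≤ n (ℕ.≤-trans (ℕ.n≤1+n 2) n≥3))
           (ℕ.+-monoʳ-≤ n (ℕ.m≤m+n n _))))
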